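{- Let $s_\beta$ be the base phi sum of digits function, and let $I_\beta$, $C_\beta$, $D_\beta$ (indexed from $1$) be the increasing enumerations of the points of increase, constancy, and decrease of $s_\beta$, respectively. Then: (i) $I_\beta(1)=0$, and $\Delta I_\beta$ is the fixed point of the morphism on $\{1,2,4\}$ given by $1\mapsto12$, $2\mapsto4$, $4\mapsto1244$; (ii) $C_\beta(1)=2$, and $\Delta C_\beta$ is the image under the letter-to-letter projection $1\mapsto1$, $2\mapsto2$, $3\mapsto3$, $3'\mapsto3$, $4\mapsto4$ of the fixed point (starting with $2$) of the morphism on $\{1,2,3,3',4\}$ given by $1\mapsto43$, $2\mapsto21$, $3\mapsto21$, $3'\mapsto13'43$, $4\mapsto13'4$; (iii) $D_\beta(1)=6$, and $\Delta D_\beta$ is the shift by one (i.e. the word obtained by deleting the first letter) of the fixed point of the morphism on $\{2,4,5,7\}$ given by $2\mapsto542$, $4\mapsto542$, $5\mapsto7$, $7\mapsto7542$.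
   Context: Let $\varphi=(1+\sqrt5)/2$. Every natural number $N$ can be written uniquely (ignoring leading and trailing zeros) as a finite sum $N=\sum_i d_i\varphi^i$ over integers $i$ (possibly negative), with $d_i\in\{0,1\}$ and no two consecutive digits both equal to $1$; $s_\beta(N)$ is the number of digits $1$, with $s_\beta(0)=0$. $N\ge0$ is a point of increase, constancy, or decrease of $s_\beta$ according as $s_\beta(N+1)-s_\beta(N)$ is $>0$, $=0$, or $<0$. For a sequence $V=(V(n))_{n\ge1}$, $\Delta V=(V(n+1)-V(n))_{n\ge1}$, viewed as an infinite word. The fixed point of a morphism $\mu$ starting with a letter $a$ (where $\mu(a)$ begins with $a$ and has length $\ge2$) is $\lim_n\mu^n(a)$; in (i) it starts with $1$, in (ii) with $2$, and in (iii) with $7$. -}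

module Defs where

open import Data.Fin.Base using (Fin; toℕ)
open import Data.Fin.Patterns using (0F; 1F)
open import Data.Integer.Base as ℤ using (ℤ; +_; -[1+_]; _⊖_; 0ℤ; 1ℤ; -1ℤ)
import Data.Integer.Properties as ℤ
open import Data.Integer.Tactic.RingSolver using (solve-∀)
open import Data.List.Base using (List; []; _∷_; _ʳ++_; concatMap; drop; head; map)
open import Data.List.Relation.Unary.Linked as Linked using (Linked; []; [-]; _∷_)
open import Data.Maybe.Base using (just)
open import Data.Nat.Base using (ℕ; zero; suc; _≤_; _<_)
open import Data.Nat.GeneralisedArithmetic using (iterate)
open import Data.Nat.ListAction using (sum)
open import Data.Product.Base using (Σ-syntax; ∃-syntax; _×_; _,_)
open import Relation.Binary.PropositionalEquality
open import Relation.Nullary.Negation.Core using (¬_; contradiction)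

------------------------------------------------------------------------
-- The ring ℤ[φ]

-- a +φ b stands for the real number a + bφ.  As φ is irrational, two such
-- numbers are equal exactly when their coefficients are.

infix 5 _+φ_

record ℤ[φ] : Set where
  constructor _+φ_
  field
    constant    : ℤ
    coefficient : ℤ

infixl 6 _+_
infixl 7 _*_

_+_ : ℤ[φ] → ℤ[φ] → ℤ[φ]
(a +φ b) + (c +φ d) = (a ℤ.+ c) +φ (b ℤ.+ d)

-- φ² = φ + 1
_*_ : ℤ[φ] → ℤ[φ] → ℤ[φ]
(a +φ b) * (c +φ d) = (a ℤ.* c ℤ.+ b ℤ.* d) +φ (a ℤ.* d ℤ.+ b ℤ.* c ℤ.+ b ℤ.* d)

fromℕ : ℕ → ℤ[φ]
fromℕ n = + n +φ 0ℤ

0# 1# φ φ⁻¹ : ℤ[φ]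
0#  = fromℕ 0
1#  = fromℕ 1
φ   = 0ℤ +φ 1ℤ
φ⁻¹ = -1ℤ +φ 1ℤ

φ²≡φ+1 : φ * φ ≡ φ + 1#
φ²≡φ+1 = refl

φ*φ⁻¹≡1 : φ * φ⁻¹ ≡ 1#
φ*φ⁻¹≡1 = refl

pow : ℤ[φ] → ℕ → ℤ[φ]
pow x zero    = 1#
pow x (suc n) = x * pow x n

infix 8 φ^_

φ^_ : ℤ → ℤ[φ]
φ^ (+ n)    = pow φ n
φ^ -[1+ n ] = pow φ⁻¹ (suc n)

------------------------------------------------------------------------
-- Base phi expansions

Digit : Set
Digit = Fin 2

-- Digits are listed from the least significant one, which belongs to φ^ ℓ.
value : ℤ → List Digit → ℤ[φ]
value ℓ []       = 0#
value ℓ (d ∷ ds) = fromℕ (toℕ d) * φ^ ℓ + value (ℤ.suc ℓ) ds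

NotBothOne : Digit → Digit → Set
NotBothOne d e = ¬ (d ≡ 1F × e ≡ 1F)

record Expansion (N : ℕ) : Set where
  field
    lowest  : ℤ
    digits  : List Digit
    no-11   : Linked NotBothOne digits
    value≡N : value lowest digits ≡ fromℕ N

-- The sum of the digits is the number of digits 1.
digitSum : List Digit → ℕ
digitSum ds = sum (map toℕ ds)

------------------------------------------------------------------------
-- Every natural number has an expansion

module Existence where

  φ·_ φ⁻¹·_ : ℤ[φ] → ℤ[φ]
  φ· (a +φ b)   = b +φ (a ℤ.+ b)
  φ⁻¹· (a +φ b) = (b ℤ.- a) +φ a

  bit : Digit → ℤ[φ] → ℤ[φ]
  bit 0F u = 0#
  bit 1F u = u

  -- Digits at positions p, p+1, … (hi) and p-1, p-2, … (lo), where u = φᵖ.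
  hi lo : ℤ[φ] → List Digit → ℤ[φ]
  hi u []       = 0#
  hi u (d ∷ ds) = bit d u + hi (φ· u) ds
  lo u []       = 0#
  lo u (d ∷ ds) = bit d (φ⁻¹· u) + lo (φ⁻¹· u) ds

  φ*≡φ· : ∀ u → φ * u ≡ φ· u
  φ*≡φ· (a +φ b) = cong₂ _+φ_ (lem₁ a b) (lem₂ a b)
    where
    lem₁ : ∀ a b → 0ℤ ℤ.* a ℤ.+ 1ℤ ℤ.* b ≡ b
    lem₁ = solve-∀
    lem₂ : ∀ a b → 0ℤ ℤ.* b ℤ.+ 1ℤ ℤ.* a ℤ.+ 1ℤ ℤ.* b ≡ a ℤ.+ b
    lem₂ = solve-∀

  φ⁻¹*≡φ⁻¹· : ∀ u → φ⁻¹ * u ≡ φ⁻¹· u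
  φ⁻¹*≡φ⁻¹· (a +φ b) = cong₂ _+φ_ (lem₁ a b) (lem₂ a b)
    where
    lem₁ : ∀ a b → -1ℤ ℤ.* a ℤ.+ 1ℤ ℤ.* b ≡ b ℤ.- a
    lem₁ = solve-∀
    lem₂ : ∀ a b → -1ℤ ℤ.* b ℤ.+ 1ℤ ℤ.* a ℤ.+ 1ℤ ℤ.* b ≡ a
    lem₂ = solve-∀

  φ·φ⁻¹· : ∀ u → φ· (φ⁻¹· u) ≡ u
  φ·φ⁻¹· (a +φ b) = cong (a +φ_) (lem a b)
    where
    lem : ∀ a b → b ℤ.- a ℤ.+ a ≡ b
    lem = solve-∀

  digit*≡bit : ∀ d u → fromℕ (toℕ d) * u ≡ bit d u
  digit*≡bit 0F (a +φ b) = refl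
  digit*≡bit 1F (a +φ b) = cong₂ _+φ_ (lem₁ a b) (lem₂ a b)
    where
    lem₁ : ∀ a b → 1ℤ ℤ.* a ℤ.+ 0ℤ ℤ.* b ≡ a
    lem₁ = solve-∀
    lem₂ : ∀ a b → 1ℤ ℤ.* b ℤ.+ 0ℤ ℤ.* a ℤ.+ 0ℤ ℤ.* b ≡ b
    lem₂ = solve-∀

  φ^suc : ∀ ℓ → φ^ (ℤ.suc ℓ) ≡ φ· (φ^ ℓ)
  φ^suc (+ n)        = φ*≡φ· (pow φ n)
  φ^suc -[1+ zero ]  = refl
  φ^suc -[1+ suc n ] =
    sym (trans (cong φ·_ (φ⁻¹*≡φ⁻¹· (pow φ⁻¹ (suc n)))) (φ·φ⁻¹· (pow φ⁻¹ (suc n))))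

  value≡hi : ∀ ℓ ds → value ℓ ds ≡ hi (φ^ ℓ) ds
  value≡hi ℓ []       = refl
  value≡hi ℓ (d ∷ ds) = cong₂ _+_ (digit*≡bit d (φ^ ℓ))
    (trans (value≡hi (ℤ.suc ℓ) ds) (cong (λ u → hi u ds) (φ^suc ℓ)))

  Canonical : List Digit → Set
  Canonical = Linked NotBothOne

  0∷ : ∀ {ds} → Canonical ds → Canonical (0F ∷ ds)
  0∷ {[]}     c = [-]
  0∷ {d ∷ ds} c = (λ { (() , _) }) ∷ c

  -- φᵖ + φᵖ⁺¹ = φᵖ⁺²
  carry-up : ∀ u x → 0# + (0# + (φ· (φ· u) + x)) ≡ u + (φ· u + x)
  carry-up (a +φ b) (x +φ y) = cong₂ _+φ_ (lem₁ a b x) (lem₂ a b y)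
    where
    lem₁ : ∀ a b x → 0ℤ ℤ.+ (0ℤ ℤ.+ (a ℤ.+ b ℤ.+ x)) ≡ a ℤ.+ (b ℤ.+ x)
    lem₁ = solve-∀
    lem₂ : ∀ a b y → 0ℤ ℤ.+ (0ℤ ℤ.+ (b ℤ.+ (a ℤ.+ b) ℤ.+ y)) ≡ b ℤ.+ (a ℤ.+ b ℤ.+ y)
    lem₂ = solve-∀

  +-identityˡ : ∀ x → 0# + x ≡ x
  +-identityˡ (a +φ b) = cong₂ _+φ_ (ℤ.+-identityˡ a) (ℤ.+-identityˡ b)

  push : ∀ ds → Canonical ds →
         Σ[ es ∈ List Digit ] Canonical es × (∀ u → hi u es ≡ u + hi (φ· u) ds)
  push []            c = 1F ∷ [] , [-] , λ u → refl
  push (0F ∷ ds)     c = 1F ∷ 0F ∷ ds , (λ { (_ , ()) }) ∷ c , λ u → refl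
  push (1F ∷ [])     c = 0F ∷ 0F ∷ 1F ∷ [] , 0∷ (0∷ [-]) , λ u → carry-up u 0#
  push (1F ∷ 0F ∷ ds) c =
    let es , c′ , eq = push ds (Linked.tail (Linked.tail c)) in
    0F ∷ 0F ∷ es , 0∷ (0∷ c′) , λ u →
      let x = hi (φ· φ· φ· u) ds in
      trans (cong (λ z → 0# + (0# + z)) (eq (φ· φ· u)))
        (trans (carry-up u x) (cong (λ z → u + (φ· u + z)) (sym (+-identityˡ x))))
  push (1F ∷ 1F ∷ ds) c = contradiction (refl , refl) (Linked.head c)

  normalise : ∀ ds → Σ[ es ∈ List Digit ] Canonical es × (∀ u → hi u es ≡ hi u ds)
  normalise []        = [] , [] , λ u → refl
  normalise (0F ∷ ds) =
    let es , c , eq = normalise ds in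
    0F ∷ es , 0∷ c , λ u → cong (_+_ 0#) (eq (φ· u))
  normalise (1F ∷ ds) =
    let es , c , eq = normalise ds
        fs , c′ , eq′ = push es c in
    fs , c′ , λ u → trans (eq′ u) (cong (_+_ u) (eq (φ· u)))

  -- 2φᵖ = φᵖ⁺¹ + φᵖ⁻²
  carry-down : ∀ u x → u + u + x ≡ φ· u + (φ⁻¹· φ⁻¹· u + x)
  carry-down (a +φ b) (x +φ y) = cong₂ _+φ_ (lem₁ a b x) (lem₂ a b y)
    where
    lem₁ : ∀ a b x → a ℤ.+ a ℤ.+ x ≡ b ℤ.+ (a ℤ.- (b ℤ.- a) ℤ.+ x)
    lem₁ = solve-∀
    lem₂ : ∀ a b y → b ℤ.+ b ℤ.+ y ≡ (a ℤ.+ b) ℤ.+ (b ℤ.- a ℤ.+ y)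
    lem₂ = solve-∀

  carry₁ : ∀ u x → u + u + (φ⁻¹· u + x) ≡ φ· u + (u + (0# + x))
  carry₁ (a +φ b) (x +φ y) = cong₂ _+φ_ (lem₁ a b x) (lem₂ a b y)
    where
    lem₁ : ∀ a b x → a ℤ.+ a ℤ.+ (b ℤ.- a ℤ.+ x) ≡ b ℤ.+ (a ℤ.+ (0ℤ ℤ.+ x))
    lem₁ = solve-∀
    lem₂ : ∀ a b y → b ℤ.+ b ℤ.+ (a ℤ.+ y) ≡ (a ℤ.+ b) ℤ.+ (b ℤ.+ (0ℤ ℤ.+ y))
    lem₂ = solve-∀

  carry₂ : ∀ u x → u + u + (0# + (0# + x)) ≡ φ· u + (0# + (0# + (φ⁻¹· φ⁻¹· u + x)))
  carry₂ u x = begin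
    u + u + (0# + (0# + x))                        ≡⟨ cong (_+_ (u + u)) 0+0+x ⟩
    u + u + x                                      ≡⟨ carry-down u x ⟩
    φ· u + (φ⁻¹· φ⁻¹· u + x)                       ≡⟨ cong (_+_ (φ· u)) 0+0+y ⟨
    φ· u + (0# + (0# + (φ⁻¹· φ⁻¹· u + x)))         ∎
    where
    open ≡-Reasoning
    0+0+x = trans (+-identityˡ (0# + x)) (+-identityˡ x)
    y = φ⁻¹· φ⁻¹· u + x
    0+0+y = trans (+-identityˡ (0# + y)) (+-identityˡ y)

  carry₃ : ∀ u v w x y → v + v + x ≡ φ· v + (w + y) → v ≡ φ⁻¹· φ⁻¹· u →
           u + u + (0# + (v + x)) ≡ φ· u + (0# + (φ⁻¹· u + (w + y)))
  carry₃ u v w x y eq refl = begin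
    u + u + (0# + (v + x))                  ≡⟨ cong (_+_ (u + u)) (+-identityˡ (v + x)) ⟩
    u + u + (v + x)                         ≡⟨ carry-down u (v + x) ⟩
    φ· u + (v + (v + x))                    ≡⟨ cong (_+_ (φ· u)) (+-assoc v v x) ⟨
    φ· u + (v + v + x)                      ≡⟨ cong (_+_ (φ· u)) eq ⟩
    φ· u + (φ· v + (w + y))                 ≡⟨ cong (λ z → φ· u + (z + (w + y))) (φ·φ⁻¹· (φ⁻¹· u)) ⟩
    φ· u + (φ⁻¹· u + (w + y))               ≡⟨ cong (_+_ (φ· u)) (+-identityˡ _) ⟨
    φ· u + (0# + (φ⁻¹· u + (w + y)))        ∎
    where
    open ≡-Reasoning
    +-assoc : ∀ x y z → x + y + z ≡ x + (y + z)
    +-assoc (a +φ b) (c +φ d) (e +φ f) = cong₂ _+φ_ (ℤ.+-assoc a c e) (ℤ.+-assoc b d f)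

  split : ∀ fs → Σ[ d ∈ Digit ] Σ[ gs ∈ List Digit ]
          (∀ u → u + u + lo u fs ≡ φ· u + (bit d u + lo u gs))
  split []             = 0F , 0F ∷ 1F ∷ [] , λ u →
    trans (cong (_+_ (u + u)) (sym (+-identityˡ 0#))) (carry₂ u 0#)
  split (1F ∷ fs)      = 1F , 0F ∷ fs , λ u → carry₁ u (lo (φ⁻¹· u) fs)
  split (0F ∷ [])      = 0F , 0F ∷ 1F ∷ [] , λ u → carry₂ u 0#
  split (0F ∷ 0F ∷ fs) = 0F , 0F ∷ 1F ∷ fs , λ u → carry₂ u (lo (φ⁻¹· φ⁻¹· u) fs)
  split (0F ∷ 1F ∷ fs) =
    let d , gs , eq = split fs in
    0F , 1F ∷ d ∷ gs , λ u →
      let v = φ⁻¹· φ⁻¹· u in carry₃ u v (bit d v) (lo v fs) (lo v gs) (eq v) refl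

  add : ∀ fs ds → Canonical ds → Σ[ gs ∈ List Digit ] Σ[ es ∈ List Digit ]
        (∀ u → lo u gs + hi u es ≡ u + (lo u fs + hi u ds))
  add fs []        c = fs , 1F ∷ [] , λ u → swap u (lo u fs) 0#
    where
    lem : ∀ a b c → b ℤ.+ (a ℤ.+ c) ≡ a ℤ.+ (b ℤ.+ c)
    lem = solve-∀
    swap : ∀ u x y → x + (u + y) ≡ u + (x + y)
    swap (a +φ b) (c +φ d) (e +φ f) = cong₂ _+φ_ (lem a c e) (lem b d f)
  add fs (0F ∷ ds) c = fs , 1F ∷ ds , λ u → swap u (lo u fs) (hi (φ· u) ds)
    where
    lem : ∀ a b c → b ℤ.+ (a ℤ.+ c) ≡ a ℤ.+ (b ℤ.+ (0ℤ ℤ.+ c))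
    lem = solve-∀
    swap : ∀ u x y → x + (u + y) ≡ u + (x + (0# + y))
    swap (a +φ b) (c +φ d) (e +φ f) = cong₂ _+φ_ (lem a c e) (lem b d f)
  add fs (1F ∷ ds) c =
    let d , gs , eq = split fs
        es , eq′ = shifted ds c in
    gs , d ∷ es , λ u →
      trans (cong (λ z → lo u gs + (bit d u + z)) (eq′ (φ· u)))
        (rearrange u (lo u fs) (φ· u) (bit d u) (lo u gs) (hi (φ· u) ds) (eq u))
    where
    shifted : ∀ ds → Canonical (1F ∷ ds) → Σ[ es ∈ List Digit ]
              (∀ v → hi v es ≡ v + hi v ds)
    shifted []        c = 1F ∷ [] , λ v → refl
    shifted (0F ∷ ds) c = 1F ∷ ds , λ v →
      cong (_+_ v) (sym (+-identityˡ (hi (φ· v) ds)))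
    shifted (1F ∷ ds) c = contradiction (refl , refl) (Linked.head c)
    lem₁ : ∀ p d g h → g ℤ.+ (d ℤ.+ (p ℤ.+ h)) ≡ p ℤ.+ (d ℤ.+ g) ℤ.+ h
    lem₁ = solve-∀
    lem₂ : ∀ u f h → u ℤ.+ u ℤ.+ f ℤ.+ h ≡ u ℤ.+ (f ℤ.+ (u ℤ.+ h))
    lem₂ = solve-∀
    lem₁φ : ∀ p d g h → g + (d + (p + h)) ≡ p + (d + g) + h
    lem₁φ (p +φ p′) (d +φ d′) (g +φ g′) (h +φ h′) =
      cong₂ _+φ_ (lem₁ p d g h) (lem₁ p′ d′ g′ h′)
    lem₂φ : ∀ u f h → u + u + f + h ≡ u + (f + (u + h))
    lem₂φ (u +φ u′) (f +φ f′) (h +φ h′) = cong₂ _+φ_ (lem₂ u f h) (lem₂ u′ f′ h′)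
    rearrange : ∀ u f p d g h → u + u + f ≡ p + (d + g) →
                g + (d + (p + h)) ≡ u + (f + (u + h))
    rearrange u f p d g h eq =
      trans (lem₁φ p d g h) (trans (cong (λ z → z + h) (sym eq)) (lem₂φ u f h))

  -- Digits before and after the point, both read away from the point, for
  -- some representation of N in which 11 may occur.
  represent : ∀ N → Σ[ fs ∈ List Digit ] Σ[ ds ∈ List Digit ]
              lo 1# fs + hi 1# ds ≡ fromℕ N
  represent zero    = [] , [] , refl
  represent (suc N) =
    let fs , ds , eq = represent N
        es , c , eq₁ = normalise ds
        gs , hs , eq₂ = add fs es c in
    gs , hs , trans (eq₂ 1#) (cong (_+_ 1#) (trans (cong (_+_ (lo 1# fs)) (eq₁ 1#)) eq))

  join : ∀ n fs ds → Σ[ m ∈ ℕ ]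
         hi (pow φ⁻¹ m) (fs ʳ++ ds) ≡ lo (pow φ⁻¹ n) fs + hi (pow φ⁻¹ n) ds
  join n []       ds = n , sym (+-identityˡ _)
  join n (f ∷ fs) ds =
    let m , eq = join (suc n) fs (f ∷ ds)
        u = pow φ⁻¹ n in
    m , trans eq (trans
      (cong (λ v → lo v fs + (bit f v + hi (φ· v) ds)) (φ⁻¹*≡φ⁻¹· u))
      (trans (cong (λ v → lo (φ⁻¹· u) fs + (bit f (φ⁻¹· u) + hi v ds)) (φ·φ⁻¹· u))
        (lemφ (lo (φ⁻¹· u) fs) (bit f (φ⁻¹· u)) (hi u ds))))
    where
    lem : ∀ a b c → a ℤ.+ (b ℤ.+ c) ≡ b ℤ.+ a ℤ.+ c
    lem = solve-∀
    lemφ : ∀ x y z → x + (y + z) ≡ y + x + z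
    lemφ (a +φ b) (c +φ d) (e +φ f) = cong₂ _+φ_ (lem a c e) (lem b d f)

  φ^-neg : ∀ m → φ^ (ℤ.- (+ m)) ≡ pow φ⁻¹ m
  φ^-neg zero    = refl
  φ^-neg (suc m) = refl

open Existence using (represent; join; normalise; hi; value≡hi; φ^-neg)

expansion : ∀ N → Expansion N
expansion N =
  let fs , ds , eq₁ = represent N
      m , eq₂       = join 0 fs ds
      es , c , eq₃  = normalise (fs ʳ++ ds) in
  record
    { lowest  = ℤ.- (+ m)
    ; digits  = es
    ; no-11   = c
    ; value≡N = trans (value≡hi (ℤ.- (+ m)) es)
                  (trans (cong (λ u → hi u es) (φ^-neg m))
                    (trans (eq₃ (pow φ⁻¹ m)) (trans eq₂ eq₁)))
    }

-- Expansions are unique up to leading and trailing zeros, so the choice of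
-- expansion does not matter.
sβ : ℕ → ℕ
sβ N = digitSum (Expansion.digits (expansion N))

------------------------------------------------------------------------
-- Points of increase, constancy and decrease

Increase Constancy Decrease : ℕ → Set
Increase  N = sβ (suc N) ⊖ sβ N ℤ.> 0ℤ
Constancy N = sβ (suc N) ⊖ sβ N ≡ 0ℤ
Decrease  N = sβ (suc N) ⊖ sβ N ℤ.< 0ℤ

-- A sequence (V n) for n ≥ 1 is a function on ℕ whose value at 0 is ignored.
record IsIncreasingEnumeration (P : ℕ → Set) (V : ℕ → ℕ) : Set where
  field
    increasing : ∀ {m n} → 1 ≤ m → m < n → V m < V n
    sound      : ∀ {n} → 1 ≤ n → P (V n)
    complete   : ∀ {N} → P N → ∃[ n ] 1 ≤ n × V n ≡ N

------------------------------------------------------------------------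
-- Infinite words and morphisms

-- Letters of an infinite word are numbered from 0.
InfiniteWord : Set → Set
InfiniteWord A = ℕ → A

Δ : (ℕ → ℕ) → InfiniteWord ℤ
Δ V k = V (suc (suc k)) ⊖ V (suc k)

IsLimit : {A : Set} → (ℕ → List A) → InfiniteWord A → Set
IsLimit u w = ∀ k → ∃[ n₀ ] ∀ n → n₀ ≤ n → head (drop k (u n)) ≡ just (w k)

IsFixedPointFrom : {A : Set} → (A → List A) → A → InfiniteWord A → Set
IsFixedPointFrom μ a = IsLimit (iterate (concatMap μ) (a ∷ []))

shift : {A : Set} → InfiniteWord A → InfiniteWord A
shift w k = w (suc k)

module I where

  data Letter : Set where
    𝟏 𝟐 𝟒 : Letter

  μ : Letter → List Letter
  μ 𝟏 = 𝟏 ∷ 𝟐 ∷ []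
  μ 𝟐 = 𝟒 ∷ []
  μ 𝟒 = 𝟏 ∷ 𝟐 ∷ 𝟒 ∷ 𝟒 ∷ []

  ⟦_⟧ : Letter → ℤ
  ⟦ 𝟏 ⟧ = + 1
  ⟦ 𝟐 ⟧ = + 2
  ⟦ 𝟒 ⟧ = + 4

module C where

  data Letter : Set where
    𝟏 𝟐 𝟑 𝟑′ 𝟒 : Letter

  μ : Letter → List Letter
  μ 𝟏  = 𝟒 ∷ 𝟑 ∷ []
  μ 𝟐  = 𝟐 ∷ 𝟏 ∷ []
  μ 𝟑  = 𝟐 ∷ 𝟏 ∷ []
  μ 𝟑′ = 𝟏 ∷ 𝟑′ ∷ 𝟒 ∷ 𝟑 ∷ []
  μ 𝟒  = 𝟏 ∷ 𝟑′ ∷ 𝟒 ∷ []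

  ⟦_⟧ : Letter → ℤ
  ⟦ 𝟏 ⟧  = + 1
  ⟦ 𝟐 ⟧  = + 2
  ⟦ 𝟑 ⟧  = + 3
  ⟦ 𝟑′ ⟧ = + 3
  ⟦ 𝟒 ⟧  = + 4

module D where

  data Letter : Set where
    𝟐 𝟒 𝟓 𝟕 : Letter

  μ : Letter → List Letter
  μ 𝟐 = 𝟓 ∷ 𝟒 ∷ 𝟐 ∷ []
  μ 𝟒 = 𝟓 ∷ 𝟒 ∷ 𝟐 ∷ []
  μ 𝟓 = 𝟕 ∷ []
  μ 𝟕 = 𝟕 ∷ 𝟓 ∷ 𝟒 ∷ 𝟐 ∷ []

  ⟦_⟧ : Letter → ℤ
  ⟦ 𝟐 ⟧ = + 2
  ⟦ 𝟒 ⟧ = + 4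
  ⟦ 𝟓 ⟧ = + 5
  ⟦ 𝟕 ⟧ = + 7

{-# OPTIONS --safe #-}
module Submission where

-- Let L_k be the Lucas numbers.  Adding digits at both ends turns the expansions
-- of the numbers in [0, L_{2n+1}] and in [L_{2n+1} + 1, L_{2n+2} - 1] into those
-- of the next such intervals, because L_{2n} = φ^(2n) + φ^(-2n) and
-- L_{2n+1} = φ^(2n+1) - φ^(-2n-1).  On every translated piece the digit sum changes
-- by a constant, so the words A_n and B_n of signs of the differences of s_β on
-- these intervals, each with a final decrease, satisfy A_{n+1} = A_n B_n A_n and
-- B_{n+1} = B_n A_{n-1} B_n for n ≥ 2.  Cutting the word of signs at the increases
-- (constancies, decreases) gives words of gaps with the same recursion, and the
-- three morphisms commute with that recursion up to conjugation by a fixed word r.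

open import Defs
open import Data.Bool.Base using (Bool; true; false)
open import Data.Fin.Base using (toℕ)
open import Data.Fin.Patterns using (0F; 1F)
open import Data.Integer.Base as ℤ using (ℤ; +_; -[1+_]; _⊖_; 0ℤ; ∣_∣)
import Data.Integer.Properties as ℤ
open import Data.Integer.Tactic.RingSolver using (solve-∀)
open import Data.List.Base
  using (List; []; _∷_; _++_; [_]; map; concatMap; length; replicate; applyUpTo; head; drop)
open import Data.List.Properties
  using (++-assoc; ++-identityʳ; ++-monoid; length-++; length-replicate; map-++;
         concatMap-++; concatMap-map; map-applyUpTo)
open import Data.List.Relation.Unary.Linked as Linked using ([]; [-]; _∷_)
open import Data.Maybe.Base using (just; fromMaybe)
open import Data.Maybe.Properties using (just-injective)
open import Data.Nat.Base as ℕ using (ℕ; zero; suc; _≤_; _<_; s≤s; z≤n; z<s; s<s)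
open import Data.Nat.GeneralisedArithmetic using (iterate)
open import Data.Nat.ListAction using (sum)
open import Data.Nat.ListAction.Properties using (sum-++)
import Data.Nat.Properties as ℕ
open import Data.Product.Base using (∃-syntax; _×_; _,_; proj₁; proj₂)
open import Data.Sum.Base using (inj₁; inj₂)
open import Data.Unit.Base using (⊤; tt)
open import Function.Base using (_∘_; id)
open import Relation.Binary.Definitions using (tri<; tri≈; tri>)
open import Relation.Binary.PropositionalEquality hiding ([_])
open import Relation.Nullary.Negation.Core using (contradiction)
open import Tactic.MonoidSolver using (solve)

open Existence
  using (Canonical; 0∷; φ·_; φ⁻¹·_; bit; hi; φ·φ⁻¹·; φ*≡φ·; φ⁻¹*≡φ⁻¹·; value≡hi)
open ℤ[φ] using (coefficient)

-- Uniqueness of the digit sum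

fib : ℕ → ℕ
fib 0             = 0
fib 1             = 1
fib (suc (suc n)) = fib n ℕ.+ fib (suc n)

-- N is a sum of s Fibonacci numbers fib i with non-consecutive 2 ≤ i ≤ k.
data Zeckendorf : (k N s : ℕ) → Set where
  empty : Zeckendorf 0 0 0
  skip  : ∀ {k N s} → Zeckendorf k N s → Zeckendorf (suc k) N s
  take  : ∀ {k N s} → Zeckendorf k N s →
          Zeckendorf (suc (suc k)) (N ℕ.+ fib (suc (suc k))) (suc s)

zeckendorf-< : ∀ {k N s} → Zeckendorf k N s → N < fib (suc k)
zeckendorf-< empty    = z<s
zeckendorf-< (skip {k} z) = ℕ.<-≤-trans (zeckendorf-< z) (ℕ.m≤n+m _ (fib k))
zeckendorf-< (take {k} z) = ℕ.+-monoˡ-< (fib (suc (suc k))) (zeckendorf-< z)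

-- Greedy argument: by `zeckendorf-<` a sum without the largest Fibonacci number allowed stays below
-- that number, while a sum that takes it is at least as large. So `skip` never meets `take`.
zeckendorf-unique : ∀ {k N N′ s s′} → Zeckendorf k N s → Zeckendorf k N′ s′ →
                    N ≡ N′ → s ≡ s′
zeckendorf-unique empty    empty     eq = refl
zeckendorf-unique (skip z) (skip z′) eq = zeckendorf-unique z z′ eq
zeckendorf-unique (take {k} z) (take z′) eq =
  cong suc (zeckendorf-unique z z′ (ℕ.+-cancelʳ-≡ (fib (suc (suc k))) _ _ eq))
zeckendorf-unique (skip z) (take {N = N} z′) refl =
  contradiction (zeckendorf-< z) (ℕ.≤⇒≯ (ℕ.m≤n+m _ N))
zeckendorf-unique (take {N = N} z) (skip z′) refl =
  contradiction (zeckendorf-< z′) (ℕ.≤⇒≯ (ℕ.m≤n+m _ N))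

zeckendorf-0 : ∀ k → Zeckendorf k 0 0
zeckendorf-0 zero    = empty
zeckendorf-0 (suc k) = skip (zeckendorf-0 k)

zeckendorf-raise : ∀ {k N s} m → Zeckendorf k N s → Zeckendorf (m ℕ.+ k) N s
zeckendorf-raise zero    z = z
zeckendorf-raise (suc m) z = skip (zeckendorf-raise m z)

-- φᵏ⁺² = fib (k+1) + fib (k+2) φ, so the coefficient of φ is a Zeckendorf sum.
digits-zeckendorf : ∀ {k N s} ds → Canonical ds → Zeckendorf k N s →
  ∃[ k′ ] ∃[ m ] Zeckendorf k′ (N ℕ.+ m) (digitSum ds ℕ.+ s) ×
    coefficient (hi (+ fib (suc k) +φ + fib (suc (suc k))) ds) ≡ + m
digits-zeckendorf {k} {N} [] c z =
  k , 0 , subst (λ n → Zeckendorf k n _) (sym (ℕ.+-identityʳ N)) z , refl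
digits-zeckendorf (0F ∷ ds) c z =
  let k′ , m , z′ , eq = digits-zeckendorf ds (Linked.tail c) (skip z) in
  k′ , m , z′ , trans (ℤ.+-identityˡ _) eq
digits-zeckendorf {k} (1F ∷ []) c z =
  suc (suc k) , fib (suc (suc k)) , take z , ℤ.+-identityʳ _
digits-zeckendorf {k} {N} {s} (1F ∷ 0F ∷ ds) c z =
  let k′ , m , z′ , eq = digits-zeckendorf ds (Linked.tail (Linked.tail c)) (take z)
      f = fib (suc (suc k)) in
  k′ , f ℕ.+ m ,
  subst₂ (Zeckendorf k′) (ℕ.+-assoc N f m) (ℕ.+-suc (digitSum ds) s) z′ ,
  cong (ℤ._+_ (+ f)) (trans (ℤ.+-identityˡ _) eq)
digits-zeckendorf (1F ∷ 1F ∷ ds) c z = contradiction (refl , refl) (Linked.head c)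

φ·-distrib-+ : ∀ x y → φ· (x + y) ≡ φ· x + φ· y
φ·-distrib-+ (a +φ b) (c +φ d) = cong (b ℤ.+ d +φ_) (lem a b c d)
  where
  lem : ∀ a b c d → a ℤ.+ c ℤ.+ (b ℤ.+ d) ≡ a ℤ.+ b ℤ.+ (c ℤ.+ d)
  lem = solve-∀

bit-φ· : ∀ d u → bit d (φ· u) ≡ φ· (bit d u)
bit-φ· 0F u = refl
bit-φ· 1F u = refl

hi-φ· : ∀ u ds → hi (φ· u) ds ≡ φ· (hi u ds)
hi-φ· u []       = refl
hi-φ· u (d ∷ ds) = trans (cong₂ _+_ (bit-φ· d u) (hi-φ· (φ· u) ds))
  (sym (φ·-distrib-+ (bit d u) (hi (φ· u) ds)))

infixr 8 φ^[_]·_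

φ^[_]·_ : ℕ → ℤ[φ] → ℤ[φ]
φ^[ zero ]·  u = u
φ^[ suc n ]· u = φ· (φ^[ n ]· u)

φ^[]·-+ : ∀ m n u → φ^[ m ℕ.+ n ]· u ≡ φ^[ m ]· (φ^[ n ]· u)
φ^[]·-+ zero    n u = refl
φ^[]·-+ (suc m) n u = cong φ·_ (φ^[]·-+ m n u)

φ^[]·-φ· : ∀ n u → φ^[ n ]· (φ· u) ≡ φ· (φ^[ n ]· u)
φ^[]·-φ· zero    u = refl
φ^[]·-φ· (suc n) u = cong φ·_ (φ^[]·-φ· n u)

hi-φ^[]· : ∀ n u ds → hi (φ^[ n ]· u) ds ≡ φ^[ n ]· (hi u ds)
hi-φ^[]· zero    u ds = refl
hi-φ^[]· (suc n) u ds = trans (hi-φ· (φ^[ n ]· u) ds) (cong φ·_ (hi-φ^[]· n u ds))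

φ^[]·-fib : ∀ k → φ^[ k ]· (φ· φ· 1#) ≡ + fib (suc k) +φ + fib (suc (suc k))
φ^[]·-fib zero    = refl
φ^[]·-fib (suc k) = cong φ·_ (φ^[]·-fib k)

-- This says that u is φ to the integer exponent k - j, written with natural exponents only.
IsPower : ℤ[φ] → Set
IsPower u = ∃[ j ] ∃[ k ] φ^[ j ]· u ≡ φ^[ k ]· 1#

isPower-1# : IsPower 1#
isPower-1# = 0 , 0 , refl

isPower-φ· : ∀ {u} → IsPower u → IsPower (φ· u)
isPower-φ· (j , k , eq) = j , suc k , trans (φ^[]·-φ· j _) (cong φ·_ eq)

isPower-φ⁻¹· : ∀ {u} → IsPower u → IsPower (φ⁻¹· u)
isPower-φ⁻¹· {u} (j , k , eq) = suc j , k ,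
  trans (sym (φ^[]·-φ· j (φ⁻¹· u))) (trans (cong φ^[ j ]·_ (φ·φ⁻¹· u)) eq)

isPower-φ^ : ∀ ℓ → IsPower (φ^ ℓ)
isPower-φ^ (+ zero)     = isPower-1#
isPower-φ^ (+ suc n)    =
  subst IsPower (sym (φ*≡φ· (pow φ n))) (isPower-φ· (isPower-φ^ (+ n)))
isPower-φ^ -[1+ zero ]  = isPower-φ⁻¹· isPower-1#
isPower-φ^ -[1+ suc n ] =
  subst IsPower (sym (φ⁻¹*≡φ⁻¹· (pow φ⁻¹ (suc n)))) (isPower-φ⁻¹· (isPower-φ^ -[1+ n ]))

coefficient-zeckendorf : ∀ k ds → Canonical ds →
  ∃[ k′ ] ∃[ m ] Zeckendorf k′ m (digitSum ds) ×
    coefficient (hi (φ^[ k ]· (φ· φ· 1#)) ds) ≡ + m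
coefficient-zeckendorf k ds c =
  let k′ , m , z , eq = digits-zeckendorf ds c (zeckendorf-0 k) in
  k′ , m , subst (Zeckendorf k′ m) (ℕ.+-identityʳ _) z ,
  trans (cong (λ u → coefficient (hi u ds)) (φ^[]·-fib k)) eq

-- Multiplying both values by φ^(j + j′ + 2) moves all digits to exponents at least 2. There the
-- coefficients of φ are Zeckendorf sums with the same digit sums as before, and these sums are
-- unique.
digitSum-unique : ∀ {u u′ ds ds′} → IsPower u → IsPower u′ →
  Canonical ds → Canonical ds′ → hi u ds ≡ hi u′ ds′ → digitSum ds ≡ digitSum ds′
digitSum-unique {u} {u′} {ds} {ds′} (j , k , p) (j′ , k′ , p′) c c′ eq =
  let l  , m  , z  , q  = coefficient-zeckendorf (j′ ℕ.+ k) ds c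
      l′ , m′ , z′ , q′ = coefficient-zeckendorf (j ℕ.+ k′) ds′ c′ in
  -- The two expansions may end at different positions, so both sums are raised to the common bound
  -- `l′ + l`.
  zeckendorf-unique (zeckendorf-raise l′ z)
    (subst (λ i → Zeckendorf i m′ (digitSum ds′)) (ℕ.+-comm l l′) (zeckendorf-raise l z′))
    (ℤ.+-injective (trans (sym q) (trans (cong coefficient scaled) q′)))
  where
  open ≡-Reasoning
  rescale : ∀ i {j k} u ds → φ^[ j ]· u ≡ φ^[ k ]· 1# →
            hi (φ^[ i ℕ.+ k ]· (φ· φ· 1#)) ds ≡ φ· φ· (φ^[ i ℕ.+ j ]· hi u ds)
  rescale i {j} {k} u ds p = begin
    hi (φ^[ i ℕ.+ k ]· (φ· φ· 1#)) ds
      ≡⟨ cong (λ x → hi x ds) (φ^[]·-φ· (i ℕ.+ k) (φ· 1#)) ⟩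
    hi (φ· (φ^[ i ℕ.+ k ]· (φ· 1#))) ds
      ≡⟨ cong (λ x → hi (φ· x) ds) (φ^[]·-φ· (i ℕ.+ k) 1#) ⟩
    hi (φ· φ· (φ^[ i ℕ.+ k ]· 1#)) ds
      ≡⟨ cong (λ x → hi (φ· φ· x) ds) (φ^[]·-+ i k 1#) ⟩
    hi (φ· φ· (φ^[ i ]· (φ^[ k ]· 1#))) ds
      ≡⟨ cong (λ x → hi (φ· φ· (φ^[ i ]· x)) ds) p ⟨
    hi (φ· φ· (φ^[ i ]· (φ^[ j ]· u))) ds
      ≡⟨ cong (λ x → hi (φ· φ· x) ds) (φ^[]·-+ i j u) ⟨
    hi (φ· φ· (φ^[ i ℕ.+ j ]· u)) ds
      ≡⟨ hi-φ^[]· (suc (suc (i ℕ.+ j))) u ds ⟩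
    φ· φ· (φ^[ i ℕ.+ j ]· hi u ds) ∎
  scaled : hi (φ^[ j′ ℕ.+ k ]· (φ· φ· 1#)) ds ≡ hi (φ^[ j ℕ.+ k′ ]· (φ· φ· 1#)) ds′
  scaled = begin
    hi (φ^[ j′ ℕ.+ k ]· (φ· φ· 1#)) ds   ≡⟨ rescale j′ u ds p ⟩
    φ· φ· (φ^[ j′ ℕ.+ j ]· hi u ds)
      ≡⟨ cong₂ (λ i x → φ· φ· (φ^[ i ]· x)) (ℕ.+-comm j′ j) eq ⟩
    φ· φ· (φ^[ j ℕ.+ j′ ]· hi u′ ds′)    ≡⟨ rescale j u′ ds′ p′ ⟨
    hi (φ^[ j ℕ.+ k′ ]· (φ· φ· 1#)) ds′  ∎

sβ-unique : ∀ {N u ds} → IsPower u → Canonical ds → hi u ds ≡ fromℕ N → sβ N ≡ digitSum ds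
sβ-unique {N} p c eq =
  digitSum-unique (isPower-φ^ lowest) p no-11 c
    (trans (sym (value≡hi lowest digits)) (trans value≡N (sym eq)))
  where open Expansion (expansion N)

-- Digits added around an expansion, conjugation and Lucas numbers

top : ℤ[φ] → List Digit → ℤ[φ]
top u []       = u
top u (d ∷ ds) = top (φ· u) ds

hi-++ : ∀ u ds es → hi u (ds ++ es) ≡ hi u ds + hi (top u ds) es
hi-++ u []       es = sym (Existence.+-identityˡ _)
hi-++ u (d ∷ ds) es =
  trans (cong (_+_ (bit d u)) (hi-++ (φ· u) ds es)) (+-assoc (bit d u) _ _)
  where
  +-assoc : ∀ x y z → x + (y + z) ≡ x + y + z
  +-assoc (a +φ b) (c +φ d) (e +φ f) =
    sym (cong₂ _+φ_ (ℤ.+-assoc a c e) (ℤ.+-assoc b d f))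

top-++ : ∀ u ds es → top u (ds ++ es) ≡ top (top u ds) es
top-++ u []       es = refl
top-++ u (d ∷ ds) es = top-++ (φ· u) ds es

-- All translations of windows below have this shape: x is the weight at which the old digits `ds₂`
-- start, so they keep their value, and only the outer digits have to be compared.
hi-frame : ∀ {q x t} ds₁ ds₂ ds₃ → top q ds₁ ≡ x → top x ds₂ ≡ t →
           hi q (ds₁ ++ ds₂ ++ ds₃) ≡ hi q ds₁ + (hi x ds₂ + hi t ds₃)
hi-frame {q} {x} ds₁ ds₂ ds₃ refl refl =
  trans (hi-++ q ds₁ (ds₂ ++ ds₃)) (cong (_+_ (hi q ds₁)) (hi-++ x ds₂ ds₃))

top-frame : ∀ {q x t} ds₁ ds₂ ds₃ → top q ds₁ ≡ x → top x ds₂ ≡ t →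
            top q (ds₁ ++ ds₂ ++ ds₃) ≡ top t ds₃
top-frame {q} {x} ds₁ ds₂ ds₃ refl refl =
  trans (top-++ q ds₁ (ds₂ ++ ds₃)) (top-++ x ds₂ ds₃)

digitSum-frame : ∀ ds₁ ds₂ ds₃ →
  digitSum (ds₁ ++ ds₂ ++ ds₃) ≡ digitSum ds₁ ℕ.+ digitSum ds₃ ℕ.+ digitSum ds₂
digitSum-frame ds₁ ds₂ ds₃ = begin
  digitSum (ds₁ ++ ds₂ ++ ds₃)
    ≡⟨ digitSum-++ ds₁ (ds₂ ++ ds₃) ⟩
  digitSum ds₁ ℕ.+ digitSum (ds₂ ++ ds₃)
    ≡⟨ cong (digitSum ds₁ ℕ.+_) (digitSum-++ ds₂ ds₃) ⟩
  digitSum ds₁ ℕ.+ (digitSum ds₂ ℕ.+ digitSum ds₃)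
    ≡⟨ cong (digitSum ds₁ ℕ.+_) (ℕ.+-comm (digitSum ds₂) _) ⟩
  digitSum ds₁ ℕ.+ (digitSum ds₃ ℕ.+ digitSum ds₂)
    ≡⟨ ℕ.+-assoc (digitSum ds₁) _ _ ⟨
  digitSum ds₁ ℕ.+ digitSum ds₃ ℕ.+ digitSum ds₂ ∎
  where
  open ≡-Reasoning
  digitSum-++ : ∀ ds es → digitSum (ds ++ es) ≡ digitSum ds ℕ.+ digitSum es
  digitSum-++ ds es = trans (cong sum (map-++ toℕ ds es)) (sum-++ (map toℕ ds) (map toℕ es))

1∷0∷ : ∀ {ds} → Canonical ds → Canonical (1F ∷ 0F ∷ ds)
1∷0∷ c = (λ { (_ , ()) }) ∷ 0∷ c

++-0∷ : ∀ {ds es} → Canonical ds → Canonical (0F ∷ es) → Canonical (ds ++ 0F ∷ es)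
++-0∷ []      c′ = c′
++-0∷ [-]     c′ = (λ { (_ , ()) }) ∷ c′
++-0∷ (r ∷ c) c′ = r ∷ ++-0∷ c c′

-- The Galois conjugation, which sends φ to 1 - φ = -φ⁻¹. It expresses the weights at the upper end
-- of a window through the one at its lower end.
conj : ℤ[φ] → ℤ[φ]
conj (a +φ b) = a ℤ.+ b +φ ℤ.- b

φ⁻²·_ : ℤ[φ] → ℤ[φ]
φ⁻²· x = φ⁻¹· φ⁻¹· x

-- φ^(-2n); its conjugate is φ^(2n).
low : ℕ → ℤ[φ]
low zero    = 1#
low (suc n) = φ⁻²· low n

isPower-low : ∀ n → IsPower (low n)
isPower-low zero    = isPower-1#
isPower-low (suc n) = isPower-φ⁻¹· (isPower-φ⁻¹· (isPower-low n))

φ²·φ⁻²· : ∀ x → φ· φ· φ⁻²· x ≡ x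
φ²·φ⁻²· x = trans (cong φ·_ (φ·φ⁻¹· (φ⁻¹· x))) (φ·φ⁻¹· x)

conj-φ⁻²· : ∀ x → φ· φ· conj x ≡ conj (φ⁻²· x)
conj-φ⁻²· (a +φ b) = cong₂ _+φ_ (lem₁ a b) (lem₂ a b)
  where
  lem₁ : ∀ a b → a ℤ.+ b ℤ.+ ℤ.- b ≡ a ℤ.- (b ℤ.- a) ℤ.+ (b ℤ.- a)
  lem₁ = solve-∀
  lem₂ : ∀ a b → ℤ.- b ℤ.+ (a ℤ.+ b ℤ.+ ℤ.- b) ≡ ℤ.- (b ℤ.- a)
  lem₂ = solve-∀

-- ℓ-odd n is the Lucas number L_{2n+1} and ℓ-even n is L_{2n+2} - 1.
ℓ-odd ℓ-even : ℕ → ℕ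
ℓ-odd zero     = 1
ℓ-odd (suc n)  = ℓ-odd n ℕ.+ suc (ℓ-even n)
ℓ-even zero    = 2
ℓ-even (suc n) = ℓ-even n ℕ.+ ℓ-odd (suc n)

-- φ^(2n) + φ^(-2n) and φ^(2n+1) - φ^(-2n-1) for a + b φ = φ^(-2n)
evenTrace oddTrace : ℤ[φ] → ℤ
evenTrace (a +φ b) = a ℤ.+ (a ℤ.+ b)
oddTrace  (a +φ b) = a ℤ.- b ℤ.- b

-- Both traces obey the Lucas recurrence. The odd trace at `suc n` is obtained first and then enters
-- the next even one.
lucas : ∀ n → evenTrace (low (suc n)) ≡ + suc (ℓ-even n) × oddTrace (low n) ≡ + ℓ-odd n
lucas zero    = refl , refl
lucas (suc n) =
  let even , odd = lucas n
      odd′ = trans (lem-odd (low n)) (cong₂ ℤ._+_ odd even) in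
  trans (lem-even (low (suc n))) (cong₂ ℤ._+_ even odd′) , odd′
  where
  lem-odd : ∀ x → oddTrace (φ⁻²· x) ≡ oddTrace x ℤ.+ evenTrace (φ⁻²· x)
  lem-odd (a +φ b) = lem a b
    where
    lem : ∀ a b → a ℤ.- (b ℤ.- a) ℤ.- (b ℤ.- a) ℤ.- (b ℤ.- a) ≡
          a ℤ.- b ℤ.- b ℤ.+ (a ℤ.- (b ℤ.- a) ℤ.+ (a ℤ.- (b ℤ.- a) ℤ.+ (b ℤ.- a)))
    lem = solve-∀
  lem-even : ∀ x → evenTrace (φ⁻²· x) ≡ evenTrace x ℤ.+ oddTrace x
  lem-even (a +φ b) = lem a b
    where
    lem : ∀ a b → (a ℤ.- (b ℤ.- a) ℤ.+ (a ℤ.- (b ℤ.- a) ℤ.+ (b ℤ.- a))) ≡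
          a ℤ.+ (a ℤ.+ b) ℤ.+ (a ℤ.- b ℤ.- b)
    lem = solve-∀

evenTrace≡ : ∀ x → x + conj x ≡ evenTrace x +φ 0ℤ
evenTrace≡ (a +φ b) = cong (a ℤ.+ (a ℤ.+ b) +φ_) (ℤ.+-inverseʳ b)

oddTrace≡ : ∀ x → φ· conj x ≡ φ⁻¹· x + (oddTrace x +φ 0ℤ)
oddTrace≡ (a +φ b) = cong₂ _+φ_ (lem₁ a b) (lem₂ a b)
  where
  lem₁ : ∀ a b → ℤ.- b ≡ b ℤ.- a ℤ.+ (a ℤ.- b ℤ.- b)
  lem₁ = solve-∀
  lem₂ : ∀ a b → a ℤ.+ b ℤ.+ ℤ.- b ≡ a ℤ.+ 0ℤ
  lem₂ = solve-∀

φ⁻²·+φ· : ∀ x → φ⁻²· x + φ· x ≡ x + x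
φ⁻²·+φ· (a +φ b) = cong₂ _+φ_ (lem₁ a b) (lem₂ a b)
  where
  lem₁ : ∀ a b → a ℤ.- (b ℤ.- a) ℤ.+ b ≡ a ℤ.+ a
  lem₁ = solve-∀
  lem₂ : ∀ a b → b ℤ.- a ℤ.+ (a ℤ.+ b) ≡ b ℤ.+ b
  lem₂ = solve-∀

φ⁻²·+φ⁻¹· : ∀ x → φ⁻²· x + φ⁻¹· x ≡ x
φ⁻²·+φ⁻¹· (a +φ b) = cong₂ _+φ_ (lem₁ a b) (lem₂ a b)
  where
  lem₁ : ∀ a b → a ℤ.- (b ℤ.- a) ℤ.+ (b ℤ.- a) ≡ a
  lem₁ = solve-∀
  lem₂ : ∀ a b → b ℤ.- a ℤ.+ a ≡ b
  lem₂ = solve-∀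

φ³·+ : ∀ x → x + φ· φ· φ· x ≡ φ· φ· x + φ· φ· x
φ³·+ (a +φ b) = cong₂ _+φ_ (lem₁ a b) (lem₂ a b)
  where
  lem₁ : ∀ a b → a ℤ.+ (b ℤ.+ (a ℤ.+ b)) ≡ a ℤ.+ b ℤ.+ (a ℤ.+ b)
  lem₁ = solve-∀
  lem₂ : ∀ a b → b ℤ.+ (a ℤ.+ b ℤ.+ (b ℤ.+ (a ℤ.+ b))) ≡
                 b ℤ.+ (a ℤ.+ b) ℤ.+ (b ℤ.+ (a ℤ.+ b))
  lem₂ = solve-∀

-- Windows of digits and their translations by Lucas numbers

-- An expansion of N with digits in positions -2n, …, 2n and digit sum s.
record Window (n N s : ℕ) : Set where
  constructor window
  field
    digits    : List Digit
    canonical : Canonical digits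
    top≡      : top (low n) digits ≡ φ· conj (low n)
    value≡    : hi (low n) digits ≡ fromℕ N
    sum≡      : digitSum digits ≡ s

-- An expansion 1 0 0 middle 0 1 of N, least significant digit first, with
-- digits in positions -2n-2, …, 2n+1 and digit sum s.
record OddWindow (n N s : ℕ) : Set where
  constructor oddWindow
  field
    middle    : List Digit
    canonical : Canonical middle
    top≡      : top (φ· low n) middle ≡ conj (low n)
    value≡    : low (suc n) + (hi (φ· low n) middle + φ· conj (low n)) ≡ fromℕ N
    sum≡      : 2 ℕ.+ digitSum middle ≡ s

+-fromℕ : ∀ {x y z m n} → x ≡ y + (z +φ 0ℤ) → y ≡ fromℕ m → z ≡ + n → x ≡ fromℕ (m ℕ.+ n)
+-fromℕ refl refl refl = refl

window-sβ : ∀ {n N s} → Window n N s → sβ N ≡ s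
window-sβ {n} (window ds c t v e) = trans (sβ-unique (isPower-low n) c v) e

pad : ∀ {n N s} → Window n N s → Window (suc n) N s
pad {n} (window ds c t v e) = window (00s ++ ds ++ 00s)
  (0∷ (0∷ (++-0∷ c (0∷ [-]))))
  (trans (top-frame {q} 00s ds 00s (φ²·φ⁻²· x) t) (cong φ·_ (conj-φ⁻²· x)))
  (trans (hi-frame {q} 00s ds 00s (φ²·φ⁻²· x) t) (trans (lem (hi x ds)) v))
  (trans (digitSum-frame 00s ds 00s) e)
  where
  x = low n
  q = low (suc n)
  00s = 0F ∷ 0F ∷ []
  lem₀ : ∀ a → 0ℤ ℤ.+ (a ℤ.+ 0ℤ) ≡ a
  lem₀ = solve-∀
  lem : ∀ y → 0# + (y + 0#) ≡ y
  lem (a +φ b) = cong₂ _+φ_ (lem₀ a) (lem₀ b)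

-- A digit 1 is added at each of the positions -2n-2 and 2n+2, and these two weights sum to
-- L_{2n+2}.
window+ : ∀ {n N s} → Window n N s → Window (suc n) (N ℕ.+ suc (ℓ-even n)) (2 ℕ.+ s)
window+ {n} (window ds c t v e) = window (ds₁ ++ ds ++ ds₃)
  (1∷0∷ (++-0∷ c (0∷ [-])))
  (trans (top-frame {q} ds₁ ds ds₃ (φ²·φ⁻²· x) t) (cong φ·_ (conj-φ⁻²· x)))
  (+-fromℕ
    (trans (hi-frame {q} ds₁ ds ds₃ (φ²·φ⁻²· x) t) (trans
      (cong (λ z → q + 0# + (hi x ds + (0# + (z + 0#)))) (conj-φ⁻²· x)) (trans
      (lem q (hi x ds) (conj q))
      (cong (_+_ (hi x ds)) (evenTrace≡ q)))))
    v (proj₁ (lucas n)))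
  (trans (digitSum-frame ds₁ ds ds₃) (cong (2 ℕ.+_) e))
  where
  x = low n
  q = low (suc n)
  ds₁ = 1F ∷ 0F ∷ []
  ds₃ = 0F ∷ 1F ∷ []
  lem₀ : ∀ a b c → a ℤ.+ 0ℤ ℤ.+ (b ℤ.+ (0ℤ ℤ.+ (c ℤ.+ 0ℤ))) ≡ b ℤ.+ (a ℤ.+ c)
  lem₀ = solve-∀
  lem : ∀ x y z → x + 0# + (y + (0# + (z + 0#))) ≡ y + (x + z)
  lem (a +φ b) (c +φ d) (e +φ f) = cong₂ _+φ_ (lem₀ a c e) (lem₀ b d f)

oddWindow⇒window : ∀ {n N s} → OddWindow n N s → Window (suc n) N s
oddWindow⇒window {n} (oddWindow ds c t v e) = window (ds₁ ++ ds ++ ds₃)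
  (1∷0∷ (0∷ (++-0∷ c (0∷ (1∷0∷ [])))))
  (trans (top-frame {q} ds₁ ds ds₃ (cong φ·_ (φ²·φ⁻²· x)) t) (cong φ·_ (conj-φ⁻²· x)))
  (trans (hi-frame {q} ds₁ ds ds₃ (cong φ·_ (φ²·φ⁻²· x)) t) (trans
    (lem q (hi (φ· x) ds) (φ· conj x)) v))
  (trans (digitSum-frame ds₁ ds ds₃) e)
  where
  x = low n
  q = low (suc n)
  ds₁ = 1F ∷ 0F ∷ 0F ∷ []
  ds₃ = 0F ∷ 1F ∷ 0F ∷ []
  lem₀ : ∀ a b c → a ℤ.+ 0ℤ ℤ.+ (b ℤ.+ (0ℤ ℤ.+ (c ℤ.+ 0ℤ))) ≡ a ℤ.+ (b ℤ.+ c)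
  lem₀ = solve-∀
  lem : ∀ x y z → x + 0# + (y + (0# + (z + 0#))) ≡ x + (y + z)
  lem (a +φ b) (c +φ d) (e +φ f) = cong₂ _+φ_ (lem₀ a c e) (lem₀ b d f)

-- At the lower end the 1 at -2n-2 is replaced by 1s at -2n-4 and -2n-1, which adds φ^(-2n-2). At
-- the upper end the 1 moves from 2n+1 to 2n+3, which adds φ^(2n+2). Together this is L_{2n+2}.
oddWindow+even : ∀ {n N s} → OddWindow n N s →
                 OddWindow (suc n) (N ℕ.+ suc (ℓ-even n)) (suc s)
oddWindow+even {n} (oddWindow ds c t v e) = oddWindow (ds₁ ++ ds ++ ds₃)
  (1∷0∷ (++-0∷ c (0∷ [-])))
  (trans (top-frame {φ· y} ds₁ ds ds₃ (cong φ·_ (φ²·φ⁻²· x)) t) (conj-φ⁻²· x))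
  (+-fromℕ
    (trans (cong₂ (λ h k → q + (h + φ· k))
             (hi-frame {φ· y} ds₁ ds ds₃ (cong φ·_ (φ²·φ⁻²· x)) t)
             (sym (conj-φ⁻²· x))) (trans
      (lem q (φ· y) h (φ· conj x) (φ· φ· conj x)) (trans
      (cong₂ (λ z k → z + (h + φ· conj x) + k) (φ⁻²·+φ· y) (conj-φ⁻²· x)) (trans
      (lem′ y (h + φ· conj x) (conj y))
      (cong (_+_ (y + (h + φ· conj x))) (evenTrace≡ y))))))
    v (proj₁ (lucas n)))
  (cong suc (trans (cong suc (digitSum-frame ds₁ ds ds₃)) e))
  where
  x = low n
  y = low (suc n)
  q = low (suc (suc n))
  h = hi (φ· x) ds
  ds₁ = 1F ∷ 0F ∷ []
  ds₃ = 0F ∷ 0F ∷ []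
  lem₀ : ∀ q p h b d → q ℤ.+ (p ℤ.+ 0ℤ ℤ.+ (h ℤ.+ 0ℤ) ℤ.+ (b ℤ.+ d)) ≡ q ℤ.+ p ℤ.+ (h ℤ.+ b) ℤ.+ d
  lem₀ = solve-∀
  lem : ∀ q p h b d → q + (p + 0# + (h + 0#) + (b + d)) ≡ q + p + (h + b) + d
  lem (q +φ q′) (p +φ p′) (h +φ h′) (b +φ b′) (d +φ d′) =
    cong₂ _+φ_ (lem₀ q p h b d) (lem₀ q′ p′ h′ b′ d′)
  lem′₀ : ∀ y h d → y ℤ.+ y ℤ.+ h ℤ.+ d ≡ y ℤ.+ h ℤ.+ (y ℤ.+ d)
  lem′₀ = solve-∀
  lem′ : ∀ y h d → y + y + h + d ≡ y + h + (y + d)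
  lem′ (y +φ y′) (h +φ h′) (d +φ d′) = cong₂ _+φ_ (lem′₀ y h d) (lem′₀ y′ h′ d′)

-- The lower 1 moves from -2n-2 to -2n-4, which subtracts φ^(-2n-3), and a 1 is added at 2n+3.
-- Together this is L_{2n+3}.
oddWindow+odd : ∀ {n N s} → OddWindow n N s →
                OddWindow (suc n) (N ℕ.+ ℓ-odd (suc n)) (suc s)
oddWindow+odd {n} (oddWindow ds c t v e) = oddWindow (ds₁ ++ ds ++ ds₃)
  (0∷ (0∷ (++-0∷ c (0∷ [-]))))
  (trans (top-frame {φ· y} ds₁ ds ds₃ (cong φ·_ (φ²·φ⁻²· x)) t) (conj-φ⁻²· x))
  (+-fromℕ
    (trans (cong₂ (λ h k → q + (h + k))
             (hi-frame {φ· y} ds₁ ds ds₃ (cong φ·_ (φ²·φ⁻²· x)) t)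
             (oddTrace≡ y)) (trans
      (lem q h (φ· conj x) (φ⁻¹· y) (oddTrace y +φ 0ℤ))
      (cong (λ z → z + (h + φ· conj x) + (oddTrace y +φ 0ℤ)) (φ⁻²·+φ⁻¹· y))))
    v (proj₂ (lucas (suc n))))
  (cong suc (trans (cong suc (digitSum-frame ds₁ ds ds₃)) e))
  where
  x = low n
  y = low (suc n)
  q = low (suc (suc n))
  h = hi (φ· x) ds
  ds₁ = 0F ∷ 0F ∷ []
  ds₃ = 0F ∷ 1F ∷ []
  lem₀ : ∀ q h b p d →
    q ℤ.+ (0ℤ ℤ.+ (h ℤ.+ (0ℤ ℤ.+ (b ℤ.+ 0ℤ))) ℤ.+ (p ℤ.+ d)) ≡ q ℤ.+ p ℤ.+ (h ℤ.+ b) ℤ.+ d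
  lem₀ = solve-∀
  lem : ∀ q h b p d → q + (0# + (h + (0# + (b + 0#))) + (p + d)) ≡ q + p + (h + b) + d
  lem (q +φ q′) (h +φ h′) (b +φ b′) (p +φ p′) (d +φ d′) =
    cong₂ _+φ_ (lem₀ q h b p d) (lem₀ q′ h′ b′ p′ d′)

-- Four 1s are added around the old digits: those at -2n-6 and -2n-3 give 2φ^(-2n-4), those at 2n+2
-- and 2n+5 give 2φ^(2n+4). The sum is 2L_{2n+4}.
window⇒oddWindow : ∀ {n N s} → Window n N s →
  OddWindow (suc (suc n)) (N ℕ.+ (suc (ℓ-even (suc n)) ℕ.+ suc (ℓ-even (suc n)))) (4 ℕ.+ s)
window⇒oddWindow {n} (window ds c t v e) = oddWindow (ds₁ ++ ds ++ ds₃)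
  (1∷0∷ (0∷ (++-0∷ c (0∷ (1∷0∷ [])))))
  (trans (top-frame {φ· y} ds₁ ds ds₃ x≡ t)
    (trans (cong (λ u → φ· φ· u) (conj-φ⁻²· x)) (conj-φ⁻²· z)))
  (+-fromℕ
    (trans (cong (λ k → q + (k + φ· conj y)) (hi-frame {φ· y} ds₁ ds ds₃ x≡ t)) (trans
      (lem q (φ· y) h (φ· φ· conj x) (φ· conj y)) (trans
      (cong₂ (λ a b → h + (a + b)) (φ⁻²·+φ· y) top-double) (trans
      (lem′ h y (conj y))
      (cong (λ a → h + (a + a)) (evenTrace≡ y))))))
    v (cong₂ ℤ._+_ (proj₁ (lucas (suc n))) (proj₁ (lucas (suc n)))))
  (cong (2 ℕ.+_) (trans (digitSum-frame ds₁ ds ds₃) (cong (2 ℕ.+_) e)))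
  where
  x = low n
  z = low (suc n)
  y = low (suc (suc n))
  q = low (suc (suc (suc n)))
  h = hi x ds
  ds₁ = 1F ∷ 0F ∷ 0F ∷ []
  ds₃ = 0F ∷ 1F ∷ 0F ∷ []
  x≡ : φ· φ· φ· φ· y ≡ x
  x≡ = trans (cong (λ u → φ· φ· u) (φ²·φ⁻²· z)) (φ²·φ⁻²· x)
  top-double : φ· φ· conj x + φ· conj y ≡ conj y + conj y
  top-double = trans (cong₂ _+_ (conj-φ⁻²· x) (cong φ·_ (sym (conj-φ⁻²· z)))) (trans
    (φ³·+ (conj z)) (cong₂ _+_ (conj-φ⁻²· z) (conj-φ⁻²· z)))
  lem₀ : ∀ q p h b d →
    q ℤ.+ (p ℤ.+ 0ℤ ℤ.+ (h ℤ.+ (0ℤ ℤ.+ (b ℤ.+ 0ℤ))) ℤ.+ d) ≡ h ℤ.+ (q ℤ.+ p ℤ.+ (b ℤ.+ d))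
  lem₀ = solve-∀
  lem : ∀ q p h b d → q + (p + 0# + (h + (0# + (b + 0#))) + d) ≡ h + (q + p + (b + d))
  lem (q +φ q′) (p +φ p′) (h +φ h′) (b +φ b′) (d +φ d′) =
    cong₂ _+φ_ (lem₀ q p h b d) (lem₀ q′ p′ h′ b′ d′)
  lem′₀ : ∀ h y d → h ℤ.+ (y ℤ.+ y ℤ.+ (d ℤ.+ d)) ≡ h ℤ.+ (y ℤ.+ d ℤ.+ (y ℤ.+ d))
  lem′₀ = solve-∀
  lem′ : ∀ h y d → h + (y + y + (d + d)) ≡ h + (y + d + (y + d))
  lem′ (h +φ h′) (y +φ y′) (d +φ d′) = cong₂ _+φ_ (lem′₀ h y d) (lem′₀ h′ y′ d′)

-- The word of signs

data Direction : Set where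
  up flat down : Direction

compare : ℕ → ℕ → Direction
compare zero    zero    = flat
compare zero    (suc n) = up
compare (suc m) zero    = down
compare (suc m) (suc n) = compare m n

compare-+ : ∀ d m n → compare (d ℕ.+ m) (d ℕ.+ n) ≡ compare m n
compare-+ zero    m n = refl
compare-+ (suc d) m n = compare-+ d m n

compare-down : ∀ {m n} → n < m → compare m n ≡ down
compare-down {suc m} {zero}  _         = refl
compare-down {suc m} {suc n} (s<s n<m) = compare-down n<m

-- Q holds at (N , s), …, (M , t), where the first components are consecutive
-- integers and ds records the directions between the second components.
data Run (Q : ℕ → ℕ → Set) : (N s : ℕ) (ds : List Direction) (M t : ℕ) → Set where
  single : ∀ {N s} → Q N s → Run Q N s [] N s
  step   : ∀ {N s s′ ds M t} → Q N s → Run Q (suc N) s′ ds M t →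
           Run Q N s (compare s s′ ∷ ds) M t

module _ {Q Q′ : ℕ → ℕ → Set} where

  run-map : (∀ {N s} → Q N s → Q′ N s) → ∀ {N s ds M t} →
            Run Q N s ds M t → Run Q′ N s ds M t
  run-map f (single q) = single (f q)
  run-map f (step q r) = step (f q) (run-map f r)

  run-shift : ∀ c d → (∀ {N s} → Q N s → Q′ (N ℕ.+ c) (d ℕ.+ s)) → ∀ {N s ds M t} →
              Run Q N s ds M t → Run Q′ (N ℕ.+ c) (d ℕ.+ s) ds (M ℕ.+ c) (d ℕ.+ t)
  run-shift c d f (single q) = single (f q)
  run-shift c d f (step {s = s} {s′} q r) =
    subst (λ e → Run Q′ _ _ (e ∷ _) _ _) (compare-+ d s s′) (step (f q) (run-shift c d f r))

run-++ : ∀ {Q N s ds M t N′ s′ ds′ M′ t′} → Run Q N s ds M t → Run Q N′ s′ ds′ M′ t′ →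
         N′ ≡ suc M → Run Q N s (ds ++ compare t s′ ∷ ds′) M′ t′
run-++ (single q) r′ refl = step q r′
run-++ (step q r) r′ eq   = step q (run-++ r r′ eq)

WindowRun OddWindowRun : ℕ → (s : ℕ) → List Direction → (t : ℕ) → Set
WindowRun    n s ds t = Run (Window n) 0 s ds (ℓ-odd n) t
OddWindowRun n s ds t = Run (OddWindow n) (suc (ℓ-odd n)) s ds (ℓ-even n) t

-- The interval up to L_{2n+3} consists of [0, L_{2n+1}], the odd interval up to L_{2n+2} - 1, and
-- the first piece translated by L_{2n+2}.
windowRun-step : ∀ {n s ds t s′ ds′ t′} →
  WindowRun n s ds t → OddWindowRun n s′ ds′ t′ →
  WindowRun (suc n) s (ds ++ compare t s′ ∷ ds′ ++ compare t′ (2 ℕ.+ s) ∷ ds) (2 ℕ.+ t)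
windowRun-step {n} r r′ =
  run-++ (run-map pad r)
    (run-++ (run-map oddWindow⇒window r′) (run-shift (suc (ℓ-even n)) 2 window+ r) refl)
    refl

-- The outer pieces are the previous odd interval translated by L_{2n+4} and by L_{2n+5}. Between
-- them lies [0, L_{2n+1}] translated by 2L_{2n+4}.
oddWindowRun-step : ∀ {n s ds t s′ ds′ t′} →
  WindowRun n s ds t → OddWindowRun (suc n) s′ ds′ t′ →
  OddWindowRun (suc (suc n)) (suc s′)
    (ds′ ++ compare (suc t′) (4 ℕ.+ s) ∷ ds ++ compare (4 ℕ.+ t) (suc s′) ∷ ds′) (suc t′)
oddWindowRun-step {n} r r′ =
  run-++ (run-shift (suc (ℓ-even (suc n))) 1 oddWindow+even r′)
    (run-++ (run-shift _ 4 window⇒oddWindow r) (run-shift _ 1 oddWindow+odd r′)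
      -- The last two pieces are adjacent because L_{2n+3} + L_{2n+5} = L_{2n+1} + 2L_{2n+4}.
      (cong suc (lem (ℓ-odd n) (ℓ-even n) (ℓ-odd (suc n)) (ℓ-even (suc n)))))
    refl
  where
  lem : ∀ a b c d → (a ℕ.+ suc b) ℕ.+ (c ℕ.+ suc d) ≡ a ℕ.+ (suc (b ℕ.+ c) ℕ.+ suc d)
  lem a b c d = trans (ℕ.+-assoc a (suc b) _) (cong (a ℕ.+_) (sym (ℕ.+-assoc (suc b) c _)))

windowRun-0 : WindowRun 0 0 (up ∷ []) 1
windowRun-0 =
  step (window (0F ∷ []) [-] refl refl refl)
  (single (window (1F ∷ []) [-] refl refl refl))

-- The expansion 2 = φ + φ⁻² is too short for the shape of `OddWindow 0`, so `windowRun-step` cannot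
-- be applied at level 0 and the run starts by hand.
windowRun-1 : WindowRun 1 0 (up ∷ up ∷ flat ∷ up ∷ []) 3
windowRun-1 =
  step (pad (window (0F ∷ []) [-] refl refl refl))
  (step (pad (window (1F ∷ []) [-] refl refl refl))
  (step (window (1F ∷ 0F ∷ 0F ∷ 1F ∷ 0F ∷ []) (1∷0∷ (0∷ (1∷0∷ []))) refl refl refl)
  (run-shift 3 2 window+ windowRun-0)))

oddWindowRun-1 : OddWindowRun 1 3 (flat ∷ []) 3
oddWindowRun-1 =
  step (oddWindow (1F ∷ 0F ∷ 0F ∷ []) (1∷0∷ (0∷ [])) refl refl refl)
  (single (oddWindow (0F ∷ 0F ∷ 1F ∷ []) (0∷ (0∷ [-])) refl refl refl))

-- In the notation above, the first index of A is 1 and that of B is 2.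
module Blocks {X : Set} (_∙_ : X → X → X) (a₀ a₁ b₀ : X) where

  A B : ℕ → X
  A zero          = a₀
  A (suc zero)    = a₁
  A (suc (suc n)) = A (suc n) ∙ (B n ∙ A (suc n))
  B zero          = b₀
  B (suc n)       = B n ∙ (A n ∙ B n)

infixr 5 _++↓_

_++↓_ : List Direction → List Direction → List Direction
ds ++↓ es = ds ++ down ∷ es

pattern ++0+ ds = up ∷ up ∷ flat ∷ up ∷ ds

-- These words omit the final decrease; `_++↓_` supplies it at the junctions. The starting words are
-- explicit because at their level a junction is still flat: s_β is 3 at 4 and 5, and 4 at 13 and
-- 14.
module Interior = Blocks _++↓_
  (++0+ [])
  (++0+ (flat ∷ flat ∷ down ∷ ++0+ []))
  (flat ∷ flat ∷ up ∷ down ∷ flat ∷ [])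

module Signs = Blocks _++_
  (++0+ (down ∷ []))
  (++0+ (flat ∷ flat ∷ down ∷ ++0+ (down ∷ [])))
  (flat ∷ flat ∷ up ∷ down ∷ flat ∷ down ∷ [])

-- This is the value of s_β at L_{2n+3}.
lastSum : ℕ → ℕ
lastSum zero    = 3
lastSum (suc n) = 2 ℕ.+ lastSum n

lastSum> : ∀ n → 2 ℕ.+ n < lastSum n
lastSum> zero    = ℕ.≤-refl
lastSum> (suc n) = s<s (ℕ.m<n⇒m<1+n (lastSum> n))

-- Each step has two junctions. Leaving an odd block for the start of an even one, s_β drops by
-- computation; leaving an even block, it drops because `lastSum` grows by 2 per level and the sum
-- at the start of an odd block only by 1.
windowRun : ∀ n → WindowRun (1 ℕ.+ n) 0 (Interior.A n) (lastSum n)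
oddWindowRun : ∀ n → OddWindowRun (2 ℕ.+ n) (4 ℕ.+ n) (Interior.B n) (4 ℕ.+ n)
windowRun zero          = windowRun-1
windowRun (suc zero)    = windowRun-step windowRun-1 oddWindowRun-1
windowRun (suc (suc n)) =
  subst (λ d → WindowRun (3 ℕ.+ n) 0
                 (Interior.A (suc n) ++ d ∷ Interior.B n ++↓ Interior.A (suc n)) (lastSum (2 ℕ.+ n)))
    (compare-down (lastSum> n))
    (windowRun-step (windowRun (suc n)) (oddWindowRun n))
oddWindowRun zero       = oddWindowRun-step windowRun-0 oddWindowRun-1
oddWindowRun (suc n)    =
  subst (λ d → OddWindowRun (3 ℕ.+ n) (5 ℕ.+ n)
                 (Interior.B n ++↓ Interior.A n ++ d ∷ Interior.B n) (5 ℕ.+ n))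
    (compare-down (ℕ.<-trans (ℕ.n<1+n (suc n)) (lastSum> n)))
    (oddWindowRun-step (windowRun n) (oddWindowRun n))

-- Words, enumerations and limits

module _ {X : Set} where

  infix 4 _≼_

  _≼_ : List X → List X → Set
  xs ≼ ys = ∃[ zs ] ys ≡ xs ++ zs

  ≼-refl : ∀ {xs} → xs ≼ xs
  ≼-refl {xs} = [] , sym (++-identityʳ xs)

  ≼-trans : ∀ {xs ys zs} → xs ≼ ys → ys ≼ zs → xs ≼ zs
  ≼-trans {xs} (us , refl) (vs , refl) = us ++ vs , ++-assoc xs us vs

concatMap-≼ : ∀ {X Y : Set} (f : X → List Y) {xs ys} → xs ≼ ys → concatMap f xs ≼ concatMap f ys
concatMap-≼ f {xs} (zs , refl) = concatMap f zs , concatMap-++ f xs zs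

-- Induction along the recursion of `Blocks`. Every correspondence between two families of blocks is
-- proved by it, from three initial words and one step of each kind.
blocks-induction : (P Q : ℕ → Set) → P 0 → P 1 → Q 0 →
  (∀ {n} → P (suc n) → Q n → P (suc (suc n))) → (∀ {n} → P n → Q n → Q (suc n)) →
  ∀ n → P n × Q n
blocks-induction P Q p₀ p₁ q₀ stepP stepQ n = proveP n , proveQ n
  where
  proveP : ∀ n → P n
  proveQ : ∀ n → Q n
  proveP zero          = p₀
  proveP (suc zero)    = p₁
  proveP (suc (suc n)) = stepP (proveP (suc n)) (proveQ n)
  proveQ zero          = q₀
  proveQ (suc n)       = stepQ (proveP n) (proveQ n)

-- Two homomorphisms into a free monoid that differ by a conjugation by r,
-- where r cancels between consecutive blocks.
module Twist {X Y Z : Set} (f : List X → List Z) (g : List Y → List Z)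
  (f-++ : ∀ xs ys → f (xs ++ ys) ≡ f xs ++ f ys)
  (g-++ : ∀ xs ys → g (xs ++ ys) ≡ g xs ++ g ys) (r : List Z) where

  f-sandwich : ∀ xs ys → f (xs ++ ys ++ xs) ≡ f xs ++ f ys ++ f xs
  f-sandwich xs ys = trans (f-++ xs (ys ++ xs)) (cong (f xs ++_) (f-++ ys xs))

  g-sandwich : ∀ xs ys → g (xs ++ ys ++ xs) ≡ g xs ++ g ys ++ g xs
  g-sandwich xs ys = trans (g-++ xs (ys ++ xs)) (cong (g xs ++_) (g-++ ys xs))

  twistA : ∀ a b a′ b′ → f a ++ r ≡ g a′ → f b ≡ r ++ g b′ →
           f (a ++ b ++ a) ++ r ≡ g (a′ ++ b′ ++ a′)
  twistA a b a′ b′ p q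
    rewrite f-sandwich a b | g-sandwich a′ b′ | sym p | q = lem (f a) (g b′) r
    where
    lem : ∀ (x y r : List Z) → (x ++ (r ++ y) ++ x) ++ r ≡ (x ++ r) ++ y ++ (x ++ r)
    lem x y r = solve (++-monoid Z)

  twistB : ∀ a b a′ b′ → f a ++ r ≡ g a′ → f b ≡ r ++ g b′ →
           f (b ++ a ++ b) ≡ r ++ g (b′ ++ a′ ++ b′)
  twistB a b a′ b′ p q
    rewrite f-sandwich b a | g-sandwich b′ a′ | sym p | q = lem (f a) (g b′) r
    where
    lem : ∀ (x y r : List Z) → (r ++ y) ++ x ++ (r ++ y) ≡ r ++ (y ++ (x ++ r) ++ y)
    lem x y r = solve (++-monoid Z)

  -- The mirror image, with r before the A blocks and after the B blocks.
  cotwistA : ∀ a b a′ b′ → r ++ f a ≡ g a′ → f b ≡ g b′ ++ r →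
             r ++ f (a ++ b ++ a) ≡ g (a′ ++ b′ ++ a′)
  cotwistA a b a′ b′ p q
    rewrite f-sandwich a b | g-sandwich a′ b′ | sym p | q = lem (f a) (g b′) r
    where
    lem : ∀ (x y r : List Z) → r ++ x ++ (y ++ r) ++ x ≡ (r ++ x) ++ y ++ (r ++ x)
    lem x y r = solve (++-monoid Z)

  cotwistB : ∀ a b a′ b′ → r ++ f a ≡ g a′ → f b ≡ g b′ ++ r →
             f (b ++ a ++ b) ≡ g (b′ ++ a′ ++ b′) ++ r
  cotwistB a b a′ b′ p q
    rewrite f-sandwich b a | g-sandwich b′ a′ | sym p | q = lem (f a) (g b′) r
    where
    lem : ∀ (x y r : List Z) → (y ++ r) ++ x ++ (y ++ r) ≡ (y ++ (r ++ x) ++ y) ++ r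
    lem x y r = solve (++-monoid Z)

Reads : {X : Set} → (ℕ → X) → ℕ → List X → Set
Reads f N []       = ⊤
Reads f N (x ∷ xs) = f N ≡ x × Reads f (suc N) xs

module _ {X : Set} {f : ℕ → X} where

  reads-++ˡ : ∀ {N} xs {ys} → Reads f N (xs ++ ys) → Reads f N xs
  reads-++ˡ []       r       = tt
  reads-++ˡ (x ∷ xs) (e , r) = e , reads-++ˡ xs r

  reads-++ʳ : ∀ {N} xs {ys} → Reads f N (xs ++ ys) → Reads f (length xs ℕ.+ N) ys
  reads-++ʳ     []       r       = r
  reads-++ʳ {N} (x ∷ xs) {ys} (e , r) =
    subst (λ M → Reads f M ys) (ℕ.+-suc (length xs) N) (reads-++ʳ xs r)

  reads-map : ∀ {Y : Set} (g : X → Y) {N} xs → Reads f N xs → Reads (g ∘ f) N (map g xs)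
  reads-map g []       r       = tt
  reads-map g (x ∷ xs) (e , r) = cong g e , reads-map g xs r

  reads-≼ : ∀ {N xs ys} → xs ≼ ys → Reads f N ys → Reads f N xs
  reads-≼ {xs = xs} (zs , refl) r = reads-++ˡ xs r

direction : ℕ → Direction
direction N = compare (sβ N) (sβ (suc N))

run-reads : ∀ {Q} → (∀ {N s} → Q N s → sβ N ≡ s) → ∀ {N s ds M t} →
            Run Q N s ds M t → Reads direction N ds
run-reads sound (single q) = tt
run-reads {Q} sound (step q r) = cong₂ compare (sound q) (first r) , run-reads sound r
  where
  first : ∀ {N s ds M t} → Run Q N s ds M t → sβ N ≡ s
  first (single q) = sound q
  first (step q r) = sound q

interior-signs : ∀ n → Interior.A n ++ [ down ] ≡ Signs.A n × Interior.B n ++ [ down ] ≡ Signs.B n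
interior-signs = blocks-induction _ _ refl refl refl
  (λ {n} p q → lem (Interior.A (suc n)) (Interior.B n) p q)
  (λ {n} p q → lem (Interior.B n) (Interior.A n) q p)
  where
  lem : ∀ xs ys {xs′ ys′} → xs ++ [ down ] ≡ xs′ → ys ++ [ down ] ≡ ys′ →
        (xs ++↓ ys ++↓ xs) ++ [ down ] ≡ xs′ ++ ys′ ++ xs′
  lem xs ys refl refl = lem′ xs ys [ down ]
    where
    lem′ : ∀ (xs ys ds : List Direction) →
           (xs ++ ds ++ ys ++ ds ++ xs) ++ ds ≡ (xs ++ ds) ++ (ys ++ ds) ++ (xs ++ ds)
    lem′ xs ys ds = solve (++-monoid Direction)

-- The final decrease of the block lies just beyond its own run, so the run of the next level is
-- used, where it is the first junction.
signs-read : ∀ n → Reads direction 0 (Signs.A (suc n))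
signs-read n = reads-≼
  (rest , trans (sym (++-assoc (Interior.A (suc n)) [ down ] rest))
    (cong (_++ rest) (proj₁ (interior-signs (suc n)))))
  (run-reads window-sβ (windowRun (suc (suc n))))
  where rest = Interior.B n ++↓ Interior.A (suc n)

HasDirection : Direction → ℤ → Set
HasDirection up   z = z ℤ.> 0ℤ
HasDirection flat z = z ≡ 0ℤ
HasDirection down z = z ℤ.< 0ℤ

compare-correct : ∀ m n → HasDirection (compare m n) (n ⊖ m)
compare-correct zero    zero    = refl
compare-correct zero    (suc n) = ℤ.+<+ z<s
compare-correct (suc m) zero    = ℤ.-<+
compare-correct (suc m) (suc n) =
  subst (HasDirection (compare m n)) (sym (ℤ.[1+m]⊖[1+n]≡m⊖n n m)) (compare-correct m n)

direction-unique : ∀ d e {z} → HasDirection d z → HasDirection e z → d ≡ e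
direction-unique up   up   p q    = refl
direction-unique up   flat p refl = contradiction p (ℤ.<-irrefl refl)
direction-unique up   down p q    = contradiction p (ℤ.<-asym q)
direction-unique flat up   refl q = contradiction q (ℤ.<-irrefl refl)
direction-unique flat flat p q    = refl
direction-unique flat down refl q = contradiction q (ℤ.<-irrefl refl)
direction-unique down up   p q    = contradiction p (ℤ.<-asym q)
direction-unique down flat p refl = contradiction p (ℤ.<-irrefl refl)
direction-unique down down p q    = refl

Point : Direction → ℕ → Set
Point d N = HasDirection d (sβ (suc N) ⊖ sβ N)

is : Direction → Direction → Bool
is up   up   = true
is flat flat = true
is down down = true
is _    _    = false

is-refl : ∀ d → is d d ≡ true
is-refl up   = refl
is-refl flat = refl
is-refl down = refl

is-true : ∀ d e → is d e ≡ true → d ≡ e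
is-true up   up   _ = refl
is-true flat flat _ = refl
is-true down down _ = refl

point⇒is : ∀ d {N} → Point d N → is d (direction N) ≡ true
point⇒is d {N} p = subst (λ e → is d e ≡ true)
  (direction-unique d (direction N) p (compare-correct (sβ N) (sβ (suc N)))) (is-refl d)

is⇒point : ∀ d {N} → is d (direction N) ≡ true → Point d N
is⇒point d {N} eq =
  subst (λ e → HasDirection e (sβ (suc N) ⊖ sβ N)) (sym (is-true d (direction N) eq))
    (compare-correct (sβ N) (sβ (suc N)))

module _ {P : ℕ → Set} where
  open IsIncreasingEnumeration

  enumeration-mono : ∀ {V} → IsIncreasingEnumeration P V →
                     ∀ {m n} → m ≤ n → V (suc m) ≤ V (suc n)
  enumeration-mono e m≤n with ℕ.m≤n⇒m<n∨m≡n m≤n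
  ... | inj₁ m<n  = ℕ.<⇒≤ (increasing e z<s (s<s m<n))
  ... | inj₂ refl = ℕ.≤-refl

  -- The value `V′ (suc n)` occurs in V at some index `suc m`. If m < n, induction would give V′
  -- (n+1) = V (m+1) ≤ V n ≤ V′ n, against the growth of V′.
  enumeration-≤ : ∀ {V V′} → IsIncreasingEnumeration P V → IsIncreasingEnumeration P V′ →
                  ∀ n → V (suc n) ≤ V′ (suc n)
  enumeration-≤ {V} {V′} e e′ n with complete e (sound e′ (z<s {n}))
  ... | zero  , () , eq
  ... | suc m , _  , eq with ℕ.≤-<-connex n m
  ...   | inj₁ n≤m = ℕ.≤-trans (enumeration-mono e n≤m) (ℕ.≤-reflexive eq)
  enumeration-≤ {V} {V′} e e′ (suc n) | suc m , _ , eq | inj₂ m<1+n =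
    contradiction (increasing e′ z<s (ℕ.n<1+n (suc n))) (ℕ.≤⇒≯ (begin
      V′ (suc (suc n)) ≡⟨ eq ⟨
      V (suc m)        ≤⟨ enumeration-mono e (ℕ.≤-pred m<1+n) ⟩
      V (suc n)        ≤⟨ enumeration-≤ e e′ n ⟩
      V′ (suc n)       ∎))
    where open ℕ.≤-Reasoning

  enumeration-unique : ∀ {V V′} → IsIncreasingEnumeration P V → IsIncreasingEnumeration P V′ →
                       ∀ n → V (suc n) ≡ V′ (suc n)
  enumeration-unique e e′ n = ℕ.≤-antisym (enumeration-≤ e e′ n) (enumeration-≤ e′ e n)

gapWord : ℕ → List Bool
gapWord g = true ∷ replicate g false

reads-false : ∀ {b M} g {N} → Reads b M (replicate g false) → M ≤ N → N < g ℕ.+ M → b N ≡ false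
reads-false zero    r M≤N N<M = contradiction N<M (ℕ.≤⇒≯ M≤N)
reads-false {b} {M} (suc g) {N} (e , r) M≤N N<g+M with ℕ.m≤n⇒m<n∨m≡n M≤N
... | inj₁ M<N  = reads-false g r M<N (subst (N <_) (sym (ℕ.+-suc g M)) N<g+M)
... | inj₂ refl = e

-- γ lists the gaps minus one.
position : ℕ → (ℕ → ℕ) → ℕ → ℕ
position c γ zero    = c
position c γ (suc k) = suc (γ k ℕ.+ position c γ k)

position-shift : ∀ c γ k → position (suc (γ 0 ℕ.+ c)) (γ ∘ suc) k ≡ position c γ (suc k)
position-shift c γ zero    = refl
position-shift c γ (suc k) = cong (λ p → suc (γ (suc k) ℕ.+ p)) (position-shift c γ k)

reads-gap : ∀ {b} c γ {k K} → k < K → Reads b c (concatMap gapWord (applyUpTo γ K)) →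
            Reads b (position c γ k) (gapWord (γ k))
reads-gap c γ {zero}      {suc K} _         r = reads-++ˡ (gapWord (γ 0)) r
reads-gap {b} c γ {suc k} {suc K} (s<s k<K) r =
  subst (λ p → Reads b p (gapWord (γ (suc k)))) (position-shift c γ k)
    (reads-gap (suc (γ 0 ℕ.+ c)) (γ ∘ suc) k<K
      (subst (λ l → Reads b (suc l ℕ.+ c) (concatMap gapWord (applyUpTo (γ ∘ suc) K)))
        (length-replicate (γ 0)) (reads-++ʳ (gapWord (γ 0)) r)))

module GapEnumeration (b : ℕ → Bool) (c : ℕ) (γ : ℕ → ℕ)
  (below : ∀ {N} → N < c → b N ≡ false)
  (gap   : ∀ k → Reads b (position c γ k) (gapWord (γ k))) where

  private
    p = position c γ

  V : ℕ → ℕ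
  -- An enumeration ignores the index 0, so this is a dummy value.
  V zero    = 0
  V (suc k) = p k

  p-increasing : ∀ {k l} → k < l → p k < p l
  p-increasing {k} {suc l} (s<s k≤l) with ℕ.m≤n⇒m<n∨m≡n k≤l
  ... | inj₁ k<l  = ℕ.<-≤-trans (p-increasing k<l) (ℕ.m≤n⇒m≤1+n (ℕ.m≤n+m (p l) (γ l)))
  ... | inj₂ refl = s<s (ℕ.m≤n+m (p k) (γ k))

  k≤p : ∀ k → k ≤ p k
  k≤p zero    = z≤n
  k≤p (suc k) = ℕ.≤-<-trans (k≤p k) (p-increasing (ℕ.n<1+n k))

  locate : ∀ k {N} → N < p k → b N ≡ true → ∃[ l ] p l ≡ N
  locate zero    N<c bN = contradiction (trans (sym bN) (below N<c)) λ ()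
  locate (suc k) {N} N<p bN with ℕ.<-cmp N (p k)
  ... | tri< N<pk _ _ = locate k N<pk bN
  ... | tri≈ _ N≡pk _ = k , sym N≡pk
  ... | tri> _ _ pk<N = contradiction (trans (sym bN) (reads-false (γ k) (proj₂ (gap k)) pk<N
    (subst (N <_) (sym (ℕ.+-suc (γ k) (p k))) N<p))) λ ()

  enumeration : IsIncreasingEnumeration (λ N → b N ≡ true) V
  enumeration = record
    { increasing = λ { {suc m} {suc n} _ (s<s m<n) → p-increasing m<n }
    ; sound      = λ { {suc n} _ → proj₁ (gap n) }
    ; complete   = λ {N} bN →
        -- The search goes downwards from index `suc N`, whose point lies beyond N.
        let k , eq = locate (suc N) (k≤p (suc N)) bN in suc k , z<s , eq
    }

module LimitWord {X : Set} (default : X) (u : ℕ → List X)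
  (chain : ∀ n → u n ≼ u (suc n)) (grow : ∀ n → n < length (u n)) where

  -- By `grow`, `u k` has a letter at place k, so `fromMaybe` always finds one; by `chain`, all
  -- later words agree on it.
  word : InfiniteWord X
  word k = fromMaybe default (head (drop k (u k)))

  head-drop-++ : ∀ k (xs : List X) {ys} → k < length xs →
                 head (drop k (xs ++ ys)) ≡ head (drop k xs)
  head-drop-++ zero    (x ∷ xs) _         = refl
  head-drop-++ (suc k) (x ∷ xs) (s<s k<l) = head-drop-++ k xs k<l

  head-drop-just : ∀ k (xs : List X) → k < length xs →
                   head (drop k xs) ≡ just (fromMaybe default (head (drop k xs)))
  head-drop-just zero    (x ∷ xs) _         = refl
  head-drop-just (suc k) (x ∷ xs) (s<s k<l) = head-drop-just k xs k<l

  u-≼ : ∀ {m n} → m ≤ n → u m ≼ u n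
  u-≼ {m} {n} m≤n with ℕ.m≤n⇒m<n∨m≡n m≤n
  u-≼ {m} {suc n} m≤n | inj₁ (s<s m≤n′) = ≼-trans (u-≼ m≤n′) (chain n)
  ... | inj₂ refl = ≼-refl

  word-prefix : ∀ {xs n} → xs ≼ u n → ∀ {k} → k < length xs → head (drop k xs) ≡ just (word k)
  word-prefix {xs} {n} (ys , eq) {k} k<l with ℕ.≤-total n k
  ... | inj₁ n≤k with ≼-trans (ys , eq) (u-≼ n≤k)
  ...   | zs , eq′ = begin
    head (drop k xs)          ≡⟨ head-drop-++ k xs k<l ⟨
    head (drop k (xs ++ zs))  ≡⟨ cong (head ∘ drop k) eq′ ⟨
    head (drop k (u k))       ≡⟨ head-drop-just k (u k) (grow k) ⟩
    just (word k)             ∎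
    where open ≡-Reasoning
  word-prefix {xs} {n} (ys , eq) {k} k<l | inj₂ k≤n with u-≼ k≤n
  ...   | zs , eq′ = begin
    head (drop k xs)            ≡⟨ head-drop-++ k xs k<l ⟨
    head (drop k (xs ++ ys))    ≡⟨ cong (head ∘ drop k) (trans (sym eq) eq′) ⟩
    head (drop k (u k ++ zs))   ≡⟨ head-drop-++ k (u k) (grow k) ⟩
    head (drop k (u k))         ≡⟨ head-drop-just k (u k) (grow k) ⟩
    just (word k)               ∎
    where open ≡-Reasoning

  u≡applyUpTo : ∀ n → u n ≡ applyUpTo word (length (u n))
  u≡applyUpTo n = ext (u n) word (word-prefix {n = n} ≼-refl)
    where
    ext : ∀ xs (w : ℕ → X) → (∀ {k} → k < length xs → head (drop k xs) ≡ just (w k)) →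
          xs ≡ applyUpTo w (length xs)
    ext []       w eq = refl
    ext (x ∷ xs) w eq = cong₂ _∷_ (just-injective (eq z<s)) (ext xs (w ∘ suc) (eq ∘ s<s))

  module _ (μ : X → List X) (a : X) (prolong : ∃[ x ] ∃[ xs ] μ a ≡ a ∷ x ∷ xs)
    (nonerasing : ∀ x → 0 < length (μ x)) (start : [ a ] ≼ u 0)
    (μ-prefix : ∀ n → ∃[ m ] concatMap μ (u n) ≼ u m) where

    iterate-suc : ∀ {A : Set} (f : A → A) x n → iterate f x (suc n) ≡ f (iterate f x n)
    iterate-suc f x zero    = refl
    iterate-suc f x (suc n) = iterate-suc f (f x) n

    μⁿ : ℕ → List X
    μⁿ = iterate (concatMap μ) [ a ]

    μⁿ-≼ : ∀ n → ∃[ m ] μⁿ n ≼ u m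
    μⁿ-≼ zero    = 0 , start
    μⁿ-≼ (suc n) =
      let m  , p  = μⁿ-≼ n
          m′ , p′ = μ-prefix m in
      m′ , subst (_≼ u m′) (sym (iterate-suc (concatMap μ) [ a ] n))
             (≼-trans (concatMap-≼ μ p) p′)

    length-concatMap : ∀ xs → length xs ≤ length (concatMap μ xs)
    length-concatMap []       = z≤n
    length-concatMap (x ∷ xs) = subst (suc (length xs) ≤_) (sym (length-++ (μ x)))
      (ℕ.+-mono-≤ (nonerasing x) (length-concatMap xs))

    -- Each application of μ adds a letter after the leading a, and the other letters are never
    -- erased.
    μⁿ-long : ∀ n → ∃[ xs ] μⁿ n ≡ a ∷ xs × n ≤ length xs
    μⁿ-long zero    = [] , refl , z≤n
    μⁿ-long (suc n) =
      let xs , eq , n≤l = μⁿ-long n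
          x , ys , μa≡  = prolong in
      x ∷ ys ++ concatMap μ xs ,
      trans (iterate-suc (concatMap μ) [ a ] n)
        (trans (cong (concatMap μ) eq) (cong (_++ concatMap μ xs) μa≡)) ,
      s≤s (begin
        n                                    ≤⟨ n≤l ⟩
        length xs                            ≤⟨ length-concatMap xs ⟩
        length (concatMap μ xs)              ≤⟨ ℕ.m≤n+m _ (length ys) ⟩
        length ys ℕ.+ length (concatMap μ xs)  ≡⟨ length-++ ys ⟨
        length (ys ++ concatMap μ xs)        ∎)
      where open ℕ.≤-Reasoning

    -- Every iterate is a prefix of some `u m`, hence of `word`. The n-th iterate has more than n
    -- letters, so k itself serves as the threshold for place k.
    isFixedPoint : IsFixedPointFrom μ a word
    isFixedPoint k = k , λ n k≤n → word-prefix (proj₂ (μⁿ-≼ n)) (long n k≤n)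
      where
      long : ∀ n → k ≤ n → k < length (μⁿ n)
      long n k≤n = let xs , eq , n≤l = μⁿ-long n in
        subst (λ ys → k < length ys) (sym eq) (s≤s (ℕ.≤-trans k≤n n≤l))

-- The three fixed points

module WordBlocks {X : Set} (x : X) (xs : List X) (a₀ b₀ : List X) where

  open Blocks _++_ a₀ (x ∷ xs) b₀ public

  -- The chain starts at `A 1`: for constancies and decreases `A 0` is not a prefix of `A 1`.
  chain : ∀ n → A (suc n) ≼ A (suc (suc n))
  chain n = _ , refl

  grow : ∀ n → n < length (A (suc n))
  grow zero    = z<s
  grow (suc n) = begin-strict
    suc n                                ≡⟨ ℕ.+-comm 1 n ⟩
    n ℕ.+ 1                                <⟨ ℕ.+-mono-<-≤ (grow n) (ℕ.≤-<-trans z≤n (grow n)) ⟩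
    length (A (suc n)) ℕ.+ length (A (suc n))
      ≤⟨ ℕ.+-monoʳ-≤ (length (A (suc n))) (ℕ.m≤n+m _ (length (B n))) ⟩
    length (A (suc n)) ℕ.+ (length (B n) ℕ.+ length (A (suc n)))
      ≡⟨ cong (λ l → length (A (suc n)) ℕ.+ l) (length-++ (B n)) ⟨
    length (A (suc n)) ℕ.+ length (B n ++ A (suc n))
      ≡⟨ length-++ (A (suc n)) ⟨
    length (A (suc (suc n)))             ∎
    where open ℕ.≤-Reasoning

module Gaps {X : Set} (⟦_⟧ : X → ℤ) (⟦⟧-positive : ∀ x → ⟦ x ⟧ ≡ + suc (ℕ.pred ∣ ⟦ x ⟧ ∣)) where

  gap : X → ℕ
  gap x = ℕ.pred ∣ ⟦ x ⟧ ∣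

  decode : List X → List Bool
  decode = concatMap (gapWord ∘ gap)

  decode-++ : ∀ xs ys → decode (xs ++ ys) ≡ decode xs ++ decode ys
  decode-++ = concatMap-++ (gapWord ∘ gap)

  module _ (d : Direction) (c : ℕ) (w : InfiniteWord X)
    (below : Reads (is d ∘ direction) 0 (replicate c false))
    (reads : ∀ k → ∃[ K ] k < K × Reads (is d ∘ direction) c (decode (applyUpTo w K)))
    where

    private
      b = is d ∘ direction
      γ = gap ∘ w

      reads-γ : ∀ k → Reads b (position c γ k) (gapWord (γ k))
      reads-γ k =
        let K , k<K , r = reads k in
        reads-gap c γ k<K (subst (Reads b c) (sym
          (trans (cong (concatMap gapWord) (sym (map-applyUpTo w gap K)))
            (concatMap-map gapWord gap (applyUpTo w K)))) r)

    open GapEnumeration b c γ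
      (λ {N} N<c → reads-false c below z≤n (subst (N <_) (sym (ℕ.+-identityʳ c)) N<c))
      reads-γ

    points : IsIncreasingEnumeration (Point d) V
    points = record
      { increasing = increasing
      ; sound      = λ {n} 1≤n → is⇒point d {V n} (sound 1≤n)
      ; complete   = λ {N} p → complete (point⇒is d {N} p)
      }
      where open IsIncreasingEnumeration enumeration

    -- Enumerations of the same points agree from index 1 on, so it is enough to compute with the
    -- one built from the gaps.
    points-Δ : ∀ W → IsIncreasingEnumeration (Point d) W → W 1 ≡ c × Δ W ≗ ⟦_⟧ ∘ w
    points-Δ W e = W≡ 0 , λ k → begin
      W (suc (suc k)) ⊖ W (suc k)         ≡⟨ cong₂ _⊖_ (W≡ (suc k)) (W≡ k) ⟩
      suc (γ k ℕ.+ p k) ⊖ p k               ≡⟨ ℤ.⊖-≥ (ℕ.m≤n+m (p k) (suc (γ k))) ⟩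
      + (suc (γ k) ℕ.+ p k ℕ.∸ p k)         ≡⟨ cong (λ n → + n) (ℕ.m+n∸n≡m (suc (γ k)) (p k)) ⟩
      + suc (γ k)                         ≡⟨ ⟦⟧-positive (w k) ⟨
      ⟦ w k ⟧                             ∎
      where
      open ≡-Reasoning
      p = position c γ
      W≡ : ∀ k → W (suc k) ≡ p k
      W≡ = enumeration-unique e points

module Increases where
  open I

  ⟦⟧-positive : ∀ x → ⟦ x ⟧ ≡ + suc (ℕ.pred ∣ ⟦ x ⟧ ∣)
  ⟦⟧-positive 𝟏 = refl
  ⟦⟧-positive 𝟐 = refl
  ⟦⟧-positive 𝟒 = refl

  open Gaps ⟦_⟧ ⟦⟧-positive
  open WordBlocks 𝟏 (𝟐 ∷ 𝟒 ∷ 𝟏 ∷ 𝟐 ∷ 𝟒 ∷ []) (𝟏 ∷ 𝟐 ∷ 𝟒 ∷ []) (𝟒 ∷ [])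
  open LimitWord 𝟏 (A ∘ suc) chain grow

  -- The morphism raises the level by one up to conjugation by the letter 4. Here μ yields the extra
  -- letter at the end of an A block and lacks it at the start of a B block.
  μ-blocks : ∀ n → A (suc n) ++ [ 𝟒 ] ≡ concatMap μ (A n) × B (suc n) ≡ [ 𝟒 ] ++ concatMap μ (B n)
  μ-blocks = blocks-induction _ _ refl refl refl
    (λ {n} → twistA (A (suc (suc n))) (B (suc n)) (A (suc n)) (B n))
    (λ {n} → twistB (A (suc n)) (B (suc n)) (A n) (B n))
    where open Twist id (concatMap μ) (λ _ _ → refl) (concatMap-++ μ) [ 𝟒 ]

  B-starts : ∀ n → [ 𝟒 ] ≼ B n
  B-starts zero    = [] , refl
  B-starts (suc n) = ≼-trans (B-starts n) (A n ++ B n , refl)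

  -- The image of `A (suc n)` exceeds `A (suc (suc n))` by a 4. One level higher the following B
  -- block supplies this letter.
  μ-prefix : ∀ n → ∃[ m ] concatMap μ (A (suc n)) ≼ A (suc m)
  μ-prefix n = suc (suc n) , subst (_≼ A (suc (suc (suc n)))) (proj₁ (μ-blocks (suc n)))
    (let zs , eq = B-starts (suc n) ; a = A (suc (suc n)) in
     zs ++ a , trans (cong (λ b → a ++ b ++ a) eq) (lem a [ 𝟒 ] zs))
    where
    lem : ∀ (a r z : List Letter) → a ++ (r ++ z) ++ a ≡ (a ++ r) ++ z ++ a
    lem a r z = solve (++-monoid Letter)

  fixedPoint : IsFixedPointFrom μ 𝟏 word
  fixedPoint = isFixedPoint μ 𝟏 (𝟐 , [] , refl)
    (λ { 𝟏 → z<s ; 𝟐 → z<s ; 𝟒 → z<s }) (_ , refl) μ-prefix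

  ups : List Direction → List Bool
  ups = map (is up)

  -- A block B begins with two letters that belong to the last gap of the preceding block A.
  decode-blocks : ∀ n → ups (Signs.A n) ++ false ∷ false ∷ [] ≡ decode (A n) ×
                        ups (Signs.B n) ≡ false ∷ false ∷ decode (B n)
  decode-blocks = blocks-induction _ _ refl refl refl
    (λ {n} → twistA (Signs.A (suc n)) (Signs.B n) (A (suc n)) (B n))
    (λ {n} → twistB (Signs.A n) (Signs.B n) (A n) (B n))
    where open Twist ups decode (map-++ (is up)) decode-++ (false ∷ false ∷ [])

  -- The last gap of the block extends two places into the next B block, so the signs of one more
  -- level are read.
  decode-read : ∀ n → Reads (is up ∘ direction) 0 (decode (A (suc n)))
  decode-read n = reads-≼ (_ , prefix) (reads-map (is up) _ (signs-read (suc n)))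
    where
    lem : ∀ (a r z : List Bool) → a ++ (r ++ z) ++ a ≡ (a ++ r) ++ z ++ a
    lem a r z = solve (++-monoid Bool)
    prefix : ups (Signs.A (suc (suc n))) ≡
             decode (A (suc n)) ++ decode (B n) ++ ups (Signs.A (suc n))
    prefix = begin
      ups (Signs.A (suc (suc n)))
        ≡⟨ Twist.f-sandwich ups decode (map-++ (is up)) decode-++ []
             (Signs.A (suc n)) (Signs.B n) ⟩
      ups (Signs.A (suc n)) ++ ups (Signs.B n) ++ ups (Signs.A (suc n))
        ≡⟨ cong (λ b → ups (Signs.A (suc n)) ++ b ++ ups (Signs.A (suc n)))
             (proj₂ (decode-blocks n)) ⟩
      ups (Signs.A (suc n)) ++ (false ∷ false ∷ decode (B n)) ++ ups (Signs.A (suc n))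
        ≡⟨ lem (ups (Signs.A (suc n))) (false ∷ false ∷ []) (decode (B n)) ⟩
      (ups (Signs.A (suc n)) ++ false ∷ false ∷ []) ++ decode (B n) ++ ups (Signs.A (suc n))
        ≡⟨ cong (_++ decode (B n) ++ ups (Signs.A (suc n))) (proj₁ (decode-blocks (suc n))) ⟩
      decode (A (suc n)) ++ decode (B n) ++ ups (Signs.A (suc n)) ∎
      where open ≡-Reasoning

  word-read : ∀ k → ∃[ K ] k < K × Reads (is up ∘ direction) 0 (decode (applyUpTo word K))
  word-read k = length (A (suc k)) , grow k ,
    subst (Reads _ 0 ∘ decode) (u≡applyUpTo k) (decode-read k)

  enumeration = points up 0 word tt word-read
  Δ≗word = points-Δ up 0 word tt word-read

module Constancies where
  open C

  ⟦⟧-positive : ∀ x → ⟦ x ⟧ ≡ + suc (ℕ.pred ∣ ⟦ x ⟧ ∣)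
  ⟦⟧-positive 𝟏  = refl
  ⟦⟧-positive 𝟐  = refl
  ⟦⟧-positive 𝟑  = refl
  ⟦⟧-positive 𝟑′ = refl
  ⟦⟧-positive 𝟒  = refl

  open Gaps ⟦_⟧ ⟦⟧-positive
  open WordBlocks 𝟐 (𝟏 ∷ 𝟒 ∷ 𝟑 ∷ []) (𝟑 ∷ []) (𝟏 ∷ 𝟑′ ∷ 𝟒 ∷ [])
  open LimitWord 𝟐 (A ∘ suc) chain grow

  -- Conjugation by 43. The letter `𝟑` stems from the starting A words and `𝟑′` from the starting B
  -- word; their images differ accordingly.
  μ-blocks : ∀ n → concatMap μ (A n) ++ 𝟒 ∷ 𝟑 ∷ [] ≡ A (suc n) ×
                   concatMap μ (B n) ≡ 𝟒 ∷ 𝟑 ∷ B (suc n)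
  μ-blocks = blocks-induction _ _ refl refl refl
    (λ {n} → twistA (A (suc n)) (B n) (A (suc (suc n))) (B (suc n)))
    (λ {n} → twistB (A n) (B n) (A (suc n)) (B (suc n)))
    where open Twist (concatMap μ) id (concatMap-++ μ) (λ _ _ → refl) (𝟒 ∷ 𝟑 ∷ [])

  fixedPoint : IsFixedPointFrom μ 𝟐 word
  fixedPoint = isFixedPoint μ 𝟐 (𝟏 , [] , refl)
    (λ { 𝟏 → z<s ; 𝟐 → z<s ; 𝟑 → z<s ; 𝟑′ → z<s ; 𝟒 → z<s }) (_ , refl)
    (λ n → suc n , _ , sym (proj₁ (μ-blocks (suc n))))

  flats : List Direction → List Bool
  flats = map (is flat)

  -- The first two letters of a block A belong to the last gap of the preceding block B.
  decode-blocks : ∀ n → false ∷ false ∷ decode (A n) ≡ flats (Signs.A n) ×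
                        decode (B n) ≡ flats (Signs.B n) ++ false ∷ false ∷ []
  decode-blocks = blocks-induction _ _ refl refl refl
    (λ {n} → cotwistA (A (suc n)) (B n) (Signs.A (suc n)) (Signs.B n))
    (λ {n} → cotwistB (A n) (B n) (Signs.A n) (Signs.B n))
    where open Twist decode flats decode-++ (map-++ (is flat)) (false ∷ false ∷ [])

  -- The first A block has no predecessor, so its two leading letters are the numbers 0 and 1, and
  -- the gaps start at the constancy 2.
  decode-read : ∀ n → Reads (is flat ∘ direction) 0 (false ∷ false ∷ decode (A (suc n)))
  decode-read n = subst (Reads _ 0) (sym (proj₁ (decode-blocks (suc n))))
    (reads-map (is flat) _ (signs-read n))

  word-read : ∀ k → ∃[ K ] k < K × Reads (is flat ∘ direction) 2 (decode (applyUpTo word K))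
  word-read k = length (A (suc k)) , grow k ,
    subst (Reads _ 2 ∘ decode) (u≡applyUpTo k)
      (reads-++ʳ {f = is flat ∘ direction} {0} (false ∷ false ∷ []) (decode-read k))

  below : Reads (is flat ∘ direction) 0 (false ∷ false ∷ [])
  below = reads-++ˡ {f = is flat ∘ direction} {0} (false ∷ false ∷ []) (decode-read 0)

  enumeration = points flat 2 word below word-read
  Δ≗word = points-Δ flat 2 word below word-read

module Decreases where
  open D

  ⟦⟧-positive : ∀ x → ⟦ x ⟧ ≡ + suc (ℕ.pred ∣ ⟦ x ⟧ ∣)
  ⟦⟧-positive 𝟐 = refl
  ⟦⟧-positive 𝟒 = refl
  ⟦⟧-positive 𝟓 = refl
  ⟦⟧-positive 𝟕 = refl

  open Gaps ⟦_⟧ ⟦⟧-positive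
  open WordBlocks 𝟕 (𝟓 ∷ []) (𝟓 ∷ []) (𝟒 ∷ 𝟐 ∷ [])
  open LimitWord 𝟕 (A ∘ suc) chain grow

  μ-blocks : ∀ n → concatMap μ (A n) ++ [ 𝟓 ] ≡ A (suc n) ×
                   concatMap μ (B n) ≡ 𝟓 ∷ B (suc n)
  μ-blocks = blocks-induction _ _ refl refl refl
    (λ {n} → twistA (A (suc n)) (B n) (A (suc (suc n))) (B (suc n)))
    (λ {n} → twistB (A n) (B n) (A (suc n)) (B (suc n)))
    where open Twist (concatMap μ) id (concatMap-++ μ) (λ _ _ → refl) [ 𝟓 ]

  fixedPoint : IsFixedPointFrom μ 𝟕 word
  fixedPoint = isFixedPoint μ 𝟕 (𝟓 , 𝟒 ∷ 𝟐 ∷ [] , refl)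
    (λ { 𝟐 → z<s ; 𝟒 → z<s ; 𝟓 → z<s ; 𝟕 → z<s }) (_ , refl)
    (λ n → suc n , _ , sym (proj₁ (μ-blocks (suc n))))

  downs : List Direction → List Bool
  downs = map (is down)

  -- Every block ends with a decrease, so its gaps are read up to their right ends.
  decodeʳ : List Letter → List Bool
  decodeʳ = concatMap λ x → replicate (gap x) false ++ [ true ]

  decodeʳ-blocks : ∀ n → decodeʳ (A n) ++ [] ≡ downs (Signs.A n) × decodeʳ (B n) ≡ downs (Signs.B n)
  decodeʳ-blocks = blocks-induction _ _ refl refl refl
    (λ {n} → twistA (A (suc n)) (B n) (Signs.A (suc n)) (Signs.B n))
    (λ {n} → twistB (A n) (B n) (Signs.A n) (Signs.B n))
    where open Twist decodeʳ downs (concatMap-++ _) (map-++ (is down)) []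

  -- Cutting before each decrease instead of after it moves one `true` from the front to the end.
  decode-decodeʳ : ∀ xs → true ∷ decodeʳ xs ≡ decode xs ++ [ true ]
  decode-decodeʳ []       = refl
  decode-decodeʳ (x ∷ xs) = cong (true ∷_) (begin
    (replicate (gap x) false ++ [ true ]) ++ decodeʳ xs  ≡⟨ ++-assoc (replicate (gap x) false) _ _ ⟩
    replicate (gap x) false ++ true ∷ decodeʳ xs
      ≡⟨ cong (replicate (gap x) false ++_) (decode-decodeʳ xs) ⟩
    replicate (gap x) false ++ decode xs ++ [ true ]     ≡⟨ ++-assoc (replicate (gap x) false) _ _ ⟨
    (replicate (gap x) false ++ decode xs) ++ [ true ]   ∎)
    where open ≡-Reasoning

  word-readʳ : ∀ k → Reads (is down ∘ direction) 0 (decodeʳ (applyUpTo word (length (A (suc k)))))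
  word-readʳ k = subst (Reads _ 0 ∘ decodeʳ) (u≡applyUpTo k)
    (subst (Reads _ 0) (trans (sym (proj₁ (decodeʳ-blocks (suc k)))) (++-identityʳ _))
      (reads-map (is down) _ (signs-read k)))

  below : Reads (is down ∘ direction) 0 (replicate 6 false)
  below = reads-++ˡ {f = is down ∘ direction} {0} (replicate 6 false) (word-readʳ 0)

  -- The first letter 7 covers the numbers 0 to 6 and is no gap between two decreases. Without its
  -- six `false`, the decrease at 6 opens the remaining word; hence the shift.
  tail-read : ∀ K → Reads (is down ∘ direction) 0 (decodeʳ (applyUpTo word (suc K))) →
              Reads (is down ∘ direction) 6 (decode (applyUpTo (shift word) K))
  tail-read K r = reads-++ˡ (decode xs)
    (subst (Reads _ 6) (decode-decodeʳ xs)
      (reads-++ʳ {f = is down ∘ direction} {0} (replicate 6 false) r))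
    where xs = applyUpTo (shift word) K

  word-read : ∀ k → ∃[ K ] k < K ×
              Reads (is down ∘ direction) 6 (decode (applyUpTo (shift word) K))
  -- One level more is read, because the shift costs a letter.
  word-read k = lem (length (A (suc (suc k)))) (grow (suc k)) (word-readʳ (suc k))
    where
    lem : ∀ L → suc k < L → Reads (is down ∘ direction) 0 (decodeʳ (applyUpTo word L)) →
          ∃[ K ] k < K × Reads (is down ∘ direction) 6 (decode (applyUpTo (shift word) K))
    lem (suc K) (s<s k<K) r = K , k<K , tail-read K r

  enumeration = points down 6 (shift word) below word-read
  Δ≗word = points-Δ down 6 (shift word) below word-read

theorem7 : (∃[ V ] IsIncreasingEnumeration Increase V) ×
    (∃[ V ] IsIncreasingEnumeration Constancy V) ×
    (∃[ V ] IsIncreasingEnumeration Decrease V) ×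
    (∀ (Iβ Cβ Dβ : ℕ → ℕ) →
    IsIncreasingEnumeration Increase Iβ →
    IsIncreasingEnumeration Constancy Cβ →
    IsIncreasingEnumeration Decrease Dβ →
    (Iβ 1 ≡ 0 × (∃[ w ] IsFixedPointFrom I.μ I.𝟏 w × (Δ Iβ ≗ I.⟦_⟧ ∘ w))) ×
    (Cβ 1 ≡ 2 × (∃[ w ] IsFixedPointFrom C.μ C.𝟐 w × (Δ Cβ ≗ C.⟦_⟧ ∘ w))) ×
    (Dβ 1 ≡ 6 × (∃[ w ] IsFixedPointFrom D.μ D.𝟕 w × (Δ Dβ ≗ shift (D.⟦_⟧ ∘ w)))))
theorem7 =
  (_ , Increases.enumeration) , (_ , Constancies.enumeration) , (_ , Decreases.enumeration) ,
  λ Iβ Cβ Dβ eI eC eD →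
    let I₁ , ΔI = Increases.Δ≗word Iβ eI
        C₁ , ΔC = Constancies.Δ≗word Cβ eC
        D₁ , ΔD = Decreases.Δ≗word Dβ eD in
    (I₁ , _ , Increases.fixedPoint , ΔI) ,
    (C₁ , _ , Constancies.fixedPoint , ΔC) ,
    (D₁ , _ , Decreases.fixedPoint , ΔD)
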